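{- Let $\mathcal T$ be the set of ordered pairs $(a,b)$ of positive integers with $a<b$ for which $9a^2b^2-12(a+b)^2$ is a square (equivalently, the pairs $a<b$ for which there is an Eisenstein lattice equable parallelogram with sides $a\sqrt3,b\sqrt3$). Make $\mathcal T$ the vertex set of a simple graph by joining two distinct elements $(a,b)$ and $(a',b')$ by an edge if and only if there exist $x\in\mathcal S$ and $i\in\{1,2\}$ with $\pi(x)=(a,b)$ and $\pi(\phi_i(x))=(a',b')$, where $\mathcal S,\pi,\phi_1,\phi_2$ are as defined in the context. Then this graph is an infinite tree in which every vertex has degree $4$, except for the vertex $(2,4)$ (the root), which has degree $3$. Moreover, every element of $\mathcal T$ can be obtained from $(2,4)$ by successive applications of the four maps $\varphi_1,\varphi_2,\psi_1,\psi_2:\mathcal T\to\mathcal T$ defined in the context.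
   Context: A planar polygon is equable if its perimeter equals its area; an Eisenstein lattice equable parallelogram (ELEP) is an equable parallelogram with all vertices in $\mathbb{Z}[\omega]$, $\omega=-\frac12+i\frac{\sqrt3}{2}$. $\mathcal S$ is the set of triples $(s,t,u)$ of positive integers, with $s,t$ coprime, satisfying $s^2+3t^2+2u^2=6stu$. The involutions $\phi_1,\phi_2,\phi_3:\mathcal S\to\mathcal S$ are $$\phi_1(s,t,u)=(6tu-s,t,u),\quad \phi_2(s,t,u)=(s,2su-t,u),\quad \phi_3(s,t,u)=(s,t,3st-u).$$ The map $\pi:\mathcal S\to\mathcal T$ is $$\pi(s,t,u)=\left(3st-\sqrt{9s^2t^2-2(s^2+3t^2)},\ 3st+\sqrt{9s^2t^2-2(s^2+3t^2)}\right).$$ It is well defined and surjective, and each fibre of $\pi$ consists of two points interchanged by $\phi_3$. (Thus the graph on $\mathcal T$ is obtained from the graph on $\mathcal S$, whose edges join distinct solutions exchanged by some $\phi_i$, by contracting the $\phi_3$-edges.) For $(a,b)\in\mathcal T$, write $a=2q$, $b=2r$ ($a,b$ are always even); there are unique coprime positive integers $s,t$ such that $(s,t,q)\in\mathcal S$ and $\pi(s,t,q)=(a,b)$, and then also $(s,t,r)\in\mathcal S$. For $i=1,2$ define $$\varphi_i(a,b)=\pi(\phi_i(s,t,q)),\qquad \psi_i(a,b)=\pi(\phi_i(s,t,r)).$$ -}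

module Defs where

open import Data.Nat.Base using (ℕ; zero; suc; _+_; _*_; _∸_; _^_; _≤_; _<_; ∣_-_∣; z≤n; s≤s; s≤s⁻¹)
open import Data.Nat.Properties
open import Data.Nat.Coprimality as Coprimality using (Coprime)
open import Data.Nat.Divisibility using (_∣_; ∣-trans; ∣m+n∣m⇒∣n; ∣n⇒∣m*n; ∣m⇒∣m*n; ∣-refl)
open import Data.Nat.Tactic.RingSolver using (solve-∀)
open import Data.Fin.Base using (Fin; zero; suc; inject₁; fromℕ)
open import Data.Product.Base using (Σ-syntax; ∃-syntax; _×_; _,_; proj₁; proj₂)
open import Function.Base using (_∘_)
open import Function.Bundles using (_⇔_; _↣_)
open import Function.Definitions using (Injective)
open import Relation.Nullary.Decidable.Core using (yes; no)
open import Relation.Nullary.Negation.Core using (¬_; contradiction)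
open import Relation.Binary.Construct.Closure.ReflexiveTransitive using (Star)
open import Relation.Binary.Definitions using (tri<; tri≈; tri>)
open import Relation.Binary.PropositionalEquality.Core
  using (_≡_; _≢_; refl; sym; trans; cong; cong₂; subst)
open import Relation.Binary.PropositionalEquality.Properties using (module ≡-Reasoning)

record SimpleGraph : Set₁ where
  field
    Vertex     : Set
    Adj        : Vertex → Vertex → Set
    adj-sym    : ∀ {v w} → Adj v w → Adj w v
    adj-irrefl : ∀ {v} → ¬ Adj v v

module _ (G : SimpleGraph) where
  open SimpleGraph G

  Connected : Set
  Connected = ∀ v w → Star Adj v w

  record Cycle : Set where
    field
      n        : ℕ
      vertex   : Fin (3 + n) → Vertex
      distinct : Injective _≡_ _≡_ vertex
      step     : ∀ i → Adj (vertex (inject₁ i)) (vertex (suc i))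
      close    : Adj (vertex (fromℕ (2 + n))) (vertex zero)

  -- To be used with an inhabited vertex type: the empty graph satisfies this.
  IsTree : Set
  IsTree = Connected × ¬ Cycle

  HasDegree : Vertex → ℕ → Set
  HasDegree v d =
    Σ[ nbr ∈ (Fin d → Vertex) ]
      Injective _≡_ _≡_ nbr × (∀ w → Adj v w ⇔ (∃[ i ] nbr i ≡ w))

  Infinite : Set
  Infinite = ℕ ↣ Vertex

⌊√_⌋ : ℕ → ℕ
⌊√ zero ⌋ = 0
⌊√ suc n ⌋ with suc ⌊√ n ⌋ ^ 2 ≤? suc n
... | yes _ = suc ⌊√ n ⌋
... | no  _ = ⌊√ n ⌋

^2-cancel-< : ∀ m n → m ^ 2 < n ^ 2 → m < n
^2-cancel-< m n lt with m <? n
... | yes m<n = m<n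
... | no  m≮n = contradiction (^-monoˡ-≤ 2 (≮⇒≥ m≮n)) (<⇒≱ lt)

^2-injective : ∀ m n → m ^ 2 ≡ n ^ 2 → m ≡ n
^2-injective m n eq with <-cmp m n
... | tri< m<n _ _ = contradiction eq (<⇒≢ (^-monoˡ-< 2 m<n))
... | tri≈ _ m≡n _ = m≡n
... | tri> _ _ m>n = contradiction (sym eq) (<⇒≢ (^-monoˡ-< 2 m>n))

⌊√⌋-spec : ∀ n → ⌊√ n ⌋ ^ 2 ≤ n × n < suc ⌊√ n ⌋ ^ 2
⌊√⌋-spec zero = z≤n , s≤s z≤n
⌊√⌋-spec (suc n) with suc ⌊√ n ⌋ ^ 2 ≤? suc n
... | yes le = le , ≤-<-trans (proj₂ (⌊√⌋-spec n)) (^-monoˡ-< 2 (n<1+n (suc ⌊√ n ⌋)))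
... | no ≰  = m≤n⇒m≤1+n (proj₁ (⌊√⌋-spec n)) , ≰⇒> ≰

⌊√⌋-square : ∀ d → ⌊√ d ^ 2 ⌋ ≡ d
⌊√⌋-square d = ≤-antisym
  (s≤s⁻¹ (^2-cancel-< _ _ (≤-<-trans (proj₁ (⌊√⌋-spec (d ^ 2))) (^-monoˡ-< 2 (n<1+n d)))))
  (s≤s⁻¹ (^2-cancel-< _ _ (proj₂ (⌊√⌋-spec (d ^ 2)))))

record 𝒮 : Set where
  constructor mk𝒮
  field
    s t u    : ℕ
    s>0      : 0 < s
    t>0      : 0 < t
    u>0      : 0 < u
    coprime  : Coprime s t
    equation : s ^ 2 + 3 * t ^ 2 + 2 * u ^ 2 ≡ 6 * s * t * u

-- Below, ring-solver identities spell x ^ 2 out as x * (x * 1), to which it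
-- reduces, because solve-∀ does not recognise _^_ on ℕ.

-- Vieta jumping: if x is a root of α x² - α m x + c, then so is m - x.
private
  expand : ∀ α x y → α * (x * (x + y)) ≡ α * (x * (x * 1)) + α * x * y
  expand = solve-∀

module Vieta (α x m c : ℕ) (c>0 : 0 < c) (eq : α * x ^ 2 + c ≡ α * (x * m)) where

  x<m : x < m
  x<m with x <? m
  ... | yes p = p
  ... | no ¬p = contradiction
    (begin-strict
      α * x ^ 2       <⟨ m<m+n _ c>0 ⟩
      α * x ^ 2 + c   ≡⟨ eq ⟩
      α * (x * m)     ≤⟨ *-monoʳ-≤ α (*-monoʳ-≤ x (≮⇒≥ ¬p)) ⟩
      α * (x * x)     ≡⟨ cong (λ z → α * (x * z)) (sym (*-identityʳ x)) ⟩
      α * x ^ 2       ∎)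
    (<-irrefl refl)
    where open ≤-Reasoning

  jump : ℕ
  jump = m ∸ x

  x+jump : x + jump ≡ m
  x+jump = m+[n∸m]≡n (<⇒≤ x<m)

  jump>0 : 0 < jump
  jump>0 = m<n⇒0<n∸m x<m

  product : c ≡ α * x * jump
  product = +-cancelˡ-≡ (α * x ^ 2) _ _
    (trans eq (trans (cong (λ z → α * (x * z)) (sym x+jump)) (expand α x jump)))

  jump-eq : α * jump ^ 2 + c ≡ α * (jump * m)
  jump-eq = trans (cong (α * jump ^ 2 +_) product)
    (trans (lem α x jump) (cong (λ z → α * (jump * z)) x+jump))
    where
    lem : ∀ α x y → α * (y * (y * 1)) + α * x * y ≡ α * (y * (x + y))
    lem = solve-∀

  jump-jump : m ∸ jump ≡ x
  jump-jump = m∸[m∸n]≡n (<⇒≤ x<m)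

  coprime-jump : ∀ {y} → Coprime x y → y ∣ m → Coprime jump y
  coprime-jump cop y∣m {d} (d∣j , d∣y) = cop (d∣x , d∣y)
    where
    d∣x : d ∣ x
    d∣x = ∣m+n∣m⇒∣n (subst (d ∣_) (trans (sym x+jump) (+-comm x jump)) (∣-trans d∣y y∣m)) d∣j

0<*^2 : ∀ k x → 0 < k → 0 < x → 0 < k * x ^ 2
0<*^2 k x k>0 x>0 = *-mono-≤ k>0 (^-monoˡ-≤ 2 x>0)

module _ (x : 𝒮) where
  open 𝒮 x

  private
    eq-s : 1 * s ^ 2 + (3 * t ^ 2 + 2 * u ^ 2) ≡ 1 * (s * (6 * t * u))
    eq-s = trans (lhs s t u) (trans equation (rhs s t u))
      where
      lhs : ∀ s t u → 1 * (s * (s * 1)) + (3 * (t * (t * 1)) + 2 * (u * (u * 1))) ≡ (s * (s * 1)) + 3 * (t * (t * 1)) + 2 * (u * (u * 1))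
      lhs = solve-∀
      rhs : ∀ s t u → 6 * s * t * u ≡ 1 * (s * (6 * t * u))
      rhs = solve-∀

    eq-t : 3 * t ^ 2 + (s ^ 2 + 2 * u ^ 2) ≡ 3 * (t * (2 * s * u))
    eq-t = trans (lhs s t u) (trans equation (rhs s t u))
      where
      lhs : ∀ s t u → 3 * (t * (t * 1)) + ((s * (s * 1)) + 2 * (u * (u * 1))) ≡ (s * (s * 1)) + 3 * (t * (t * 1)) + 2 * (u * (u * 1))
      lhs = solve-∀
      rhs : ∀ s t u → 6 * s * t * u ≡ 3 * (t * (2 * s * u))
      rhs = solve-∀

    eq-u : 2 * u ^ 2 + (s ^ 2 + 3 * t ^ 2) ≡ 2 * (u * (3 * s * t))
    eq-u = trans (lhs s t u) (trans equation (rhs s t u))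
      where
      lhs : ∀ s t u → 2 * (u * (u * 1)) + ((s * (s * 1)) + 3 * (t * (t * 1))) ≡ (s * (s * 1)) + 3 * (t * (t * 1)) + 2 * (u * (u * 1))
      lhs = solve-∀
      rhs : ∀ s t u → 6 * s * t * u ≡ 2 * (u * (3 * s * t))
      rhs = solve-∀

  module Vieta-s = Vieta 1 s (6 * t * u) (3 * t ^ 2 + 2 * u ^ 2)
    (≤-trans (0<*^2 3 t (s≤s z≤n) t>0) (m≤m+n _ _)) eq-s
  module Vieta-t = Vieta 3 t (2 * s * u) (s ^ 2 + 2 * u ^ 2)
    (≤-trans (^-monoˡ-≤ 2 s>0) (m≤m+n _ _)) eq-t
  module Vieta-u = Vieta 2 u (3 * s * t) (s ^ 2 + 3 * t ^ 2)
    (≤-trans (^-monoˡ-≤ 2 s>0) (m≤m+n _ _)) eq-u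

-- The truncated subtractions in φ₁ and φ₂ never truncate on 𝒮, by Vieta.x<m.
φ₁ : 𝒮 → 𝒮
φ₁ x = record
  { s = 6 * t * u ∸ s ; t = t ; u = u
  ; s>0 = jump>0 ; t>0 = t>0 ; u>0 = u>0
  ; coprime  = coprime-jump coprime (∣m⇒∣m*n u (∣n⇒∣m*n 6 ∣-refl))
  ; equation = trans (lhs (6 * t * u ∸ s) t u) (trans jump-eq (rhs (6 * t * u ∸ s) t u))
  }
  where
  open 𝒮 x
  open Vieta-s x
  lhs : ∀ s t u → (s * (s * 1)) + 3 * (t * (t * 1)) + 2 * (u * (u * 1)) ≡ 1 * (s * (s * 1)) + (3 * (t * (t * 1)) + 2 * (u * (u * 1)))
  lhs = solve-∀
  rhs : ∀ s t u → 1 * (s * (6 * t * u)) ≡ 6 * s * t * u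
  rhs = solve-∀

φ₂ : 𝒮 → 𝒮
φ₂ x = record
  { s = s ; t = 2 * s * u ∸ t ; u = u
  ; s>0 = s>0 ; t>0 = jump>0 ; u>0 = u>0
  ; coprime  = Coprimality.sym (coprime-jump (Coprimality.sym coprime) (∣m⇒∣m*n u (∣n⇒∣m*n 2 ∣-refl)))
  ; equation = trans (lhs s (2 * s * u ∸ t) u) (trans jump-eq (rhs s (2 * s * u ∸ t) u))
  }
  where
  open 𝒮 x
  open Vieta-t x
  lhs : ∀ s t u → (s * (s * 1)) + 3 * (t * (t * 1)) + 2 * (u * (u * 1)) ≡ 3 * (t * (t * 1)) + ((s * (s * 1)) + 2 * (u * (u * 1)))
  lhs = solve-∀
  rhs : ∀ s t u → 3 * (t * (2 * s * u)) ≡ 6 * s * t * u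
  rhs = solve-∀

-- Fin 2 stands for the index set {1,2}.
φ : Fin 2 → 𝒮 → 𝒮
φ zero       = φ₁
φ (suc zero) = φ₂

-- "9a²b² - 12(a+b)² is a square", with the subtracted term moved across to
-- avoid truncated subtraction.
record 𝒯 : Set where
  constructor mk𝒯
  field
    a b    : ℕ
    a>0    : 0 < a
    a<b    : a < b
    square : ∃[ k ] 9 * a ^ 2 * b ^ 2 ≡ 12 * (a + b) ^ 2 + k ^ 2

-- All proof components are unique, so _≡_ on 𝒯 is equality of the pairs (a , b).
𝒯-≡ : ∀ {v w : 𝒯} → 𝒯.a v ≡ 𝒯.a w → 𝒯.b v ≡ 𝒯.b w → v ≡ w
𝒯-≡ {mk𝒯 a b p q (k , e)} {mk𝒯 _ _ p′ q′ (k′ , e′)} refl refl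
  with ^2-injective k k′ (+-cancelˡ-≡ (12 * (a + b) ^ 2) _ _ (trans (sym e) e′))
... | refl with <-irrelevant p p′ | <-irrelevant q q′ | ≡-irrelevant e e′
... | refl | refl | refl = refl

∣-∣^2-+ : ∀ m n → ∣ m - n ∣ ^ 2 + 4 * (m * n) ≡ (m + n) ^ 2
∣-∣^2-+ zero    n       = lem n
  where
  lem : ∀ n → (n * (n * 1)) + 0 ≡ (n * (n * 1))
  lem = solve-∀
∣-∣^2-+ (suc m) zero    = lem m
  where
  lem : ∀ m → ((1 + m) * ((1 + m) * 1)) + 4 * ((1 + m) * 0) ≡ ((1 + m + 0) * ((1 + m + 0) * 1))
  lem = solve-∀
∣-∣^2-+ (suc m) (suc n) = trans (l ∣ m - n ∣ m n)
  (trans (cong (_+ 4 * (m + n + 1)) (∣-∣^2-+ m n)) (r m n))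
  where
  l : ∀ d m n → (d * (d * 1)) + 4 * ((1 + m) * (1 + n)) ≡ (d * (d * 1)) + 4 * (m * n) + 4 * (m + n + 1)
  l = solve-∀
  r : ∀ m n → ((m + n) * ((m + n) * 1)) + 4 * (m + n + 1) ≡ (((1 + m) + (1 + n)) * (((1 + m) + (1 + n)) * 1))
  r = solve-∀

√disc : ℕ → ℕ → ℕ
√disc s t = ⌊√ 9 * s ^ 2 * t ^ 2 ∸ 2 * (s ^ 2 + 3 * t ^ 2) ⌋

module _ (x : 𝒮) where
  open 𝒮 x
  open Vieta-u x using (jump; x+jump; product)

  private
    c m d : ℕ
    c = s ^ 2 + 3 * t ^ 2
    m = 3 * s * t
    d = ∣ u - jump ∣

    d-eq : d ^ 2 + 2 * c ≡ 9 * s ^ 2 * t ^ 2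
    d-eq = trans (cong (λ z → d ^ 2 + 2 * z) product)
      (trans (cong (d ^ 2 +_) (lem u jump))
      (trans (∣-∣^2-+ u jump) (trans (cong (_^ 2) x+jump) (lem′ s t))))
      where
      lem : ∀ u v → 2 * (2 * u * v) ≡ 4 * (u * v)
      lem = solve-∀
      lem′ : ∀ s t → ((3 * s * t) * ((3 * s * t) * 1)) ≡ 9 * (s * (s * 1)) * (t * (t * 1))
      lem′ = solve-∀

    √disc≡d : √disc s t ≡ d
    √disc≡d = trans (cong ⌊√_⌋ (trans (cong (_∸ 2 * c) (sym d-eq)) (m+n∸n≡m (d ^ 2) (2 * c))))
      (⌊√⌋-square d)

  -- On 𝒮 neither the subtraction nor the square root in √disc rounds.
  √disc-exact : √disc s t ^ 2 + 2 * (s ^ 2 + 3 * t ^ 2) ≡ 9 * s ^ 2 * t ^ 2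
  √disc-exact = subst (λ z → z ^ 2 + 2 * c ≡ 9 * s ^ 2 * t ^ 2) (sym √disc≡d) d-eq

  √disc<3st : √disc s t < 3 * s * t
  √disc<3st = ^2-cancel-< _ _ (begin-strict
      √disc s t ^ 2          <⟨ m<m+n _ (*-mono-≤ {1} {2} (s≤s z≤n) c>0) ⟩
      √disc s t ^ 2 + 2 * c  ≡⟨ √disc-exact ⟩
      9 * s ^ 2 * t ^ 2      ≡⟨ lem s t ⟩
      (3 * s * t) ^ 2        ∎)
    where
    open ≤-Reasoning
    c>0 : 0 < c
    c>0 = ≤-trans (^-monoˡ-≤ 2 s>0) (m≤m+n _ _)
    lem : ∀ s t → 9 * (s * (s * 1)) * (t * (t * 1)) ≡ ((3 * s * t) * ((3 * s * t) * 1))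
    lem = solve-∀

  √disc>0 : 0 < √disc s t
  √disc>0 = ^2-cancel-< 0 _ (+-cancelʳ-< (2 * c) 0 _ (begin-strict
      2 * c                                      ≡⟨ lem s t ⟩
      2 * (s ^ 2 * 1) + 6 * (1 * t ^ 2)          ≤⟨ +-mono-≤ (*-monoʳ-≤ 2 (*-monoʳ-≤ (s ^ 2) t²>0))
                                                            (*-monoʳ-≤ 6 (*-monoˡ-≤ (t ^ 2) s²>0)) ⟩
      2 * (s ^ 2 * t ^ 2) + 6 * (s ^ 2 * t ^ 2)  <⟨ m<m+n _ (*-mono-≤ s²>0 t²>0) ⟩
      2 * (s ^ 2 * t ^ 2) + 6 * (s ^ 2 * t ^ 2) + s ^ 2 * t ^ 2
                                                 ≡⟨ lem′ (s ^ 2) (t ^ 2) ⟩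
      9 * s ^ 2 * t ^ 2                          ≡⟨ sym √disc-exact ⟩
      √disc s t ^ 2 + 2 * c                      ∎))
    where
    open ≤-Reasoning
    s²>0 : 1 ≤ s ^ 2
    s²>0 = ^-monoˡ-≤ 2 s>0
    t²>0 : 1 ≤ t ^ 2
    t²>0 = ^-monoˡ-≤ 2 t>0
    lem : ∀ s t → 2 * ((s * (s * 1)) + 3 * (t * (t * 1))) ≡ 2 * ((s * (s * 1)) * 1) + 6 * (1 * (t * (t * 1)))
    lem = solve-∀
    lem′ : ∀ p q → 2 * (p * q) + 6 * (p * q) + p * q ≡ 9 * p * q
    lem′ = solve-∀

-- Writing m = 3st, d = √disc s t, c = s² + 3t²: the pair (m - d , m + d) has
-- sum 2m and product m² - d² = 2c, whence
-- 9a²b² - 12(a+b)² = 36c² - 48m² = (6(s² - 3t²))².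
private
  square-lemma : ∀ s t e d → d ^ 2 + 2 * (s ^ 2 + 3 * t ^ 2) ≡ 9 * s ^ 2 * t ^ 2 → e + d ≡ 3 * s * t →
    9 * e ^ 2 * (3 * s * t + d) ^ 2 ≡
    12 * (e + (3 * s * t + d)) ^ 2 + (6 * ∣ s ^ 2 - 3 * t ^ 2 ∣) ^ 2
  square-lemma s t e d disc sum = begin
    9 * e ^ 2 * (3 * s * t + d) ^ 2               ≡⟨ l₁ e (3 * s * t + d) ⟩
    9 * (e * (3 * s * t + d)) ^ 2                 ≡⟨ cong (λ z → 9 * z ^ 2) prod ⟩
    9 * (2 * (s ^ 2 + 3 * t ^ 2)) ^ 2             ≡⟨ l₂ (s ^ 2 + 3 * t ^ 2) ⟩
    36 * (s ^ 2 + 3 * t ^ 2) ^ 2                  ≡⟨ cong (36 *_) (sym (∣-∣^2-+ (s ^ 2) (3 * t ^ 2))) ⟩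
    36 * (∣ s ^ 2 - 3 * t ^ 2 ∣ ^ 2 + 4 * (s ^ 2 * (3 * t ^ 2)))
                                                  ≡⟨ l₃ s t ∣ s ^ 2 - 3 * t ^ 2 ∣ ⟩
    12 * (3 * s * t + 3 * s * t) ^ 2 + (6 * ∣ s ^ 2 - 3 * t ^ 2 ∣) ^ 2
      ≡⟨ cong (λ z → 12 * z ^ 2 + (6 * ∣ s ^ 2 - 3 * t ^ 2 ∣) ^ 2) dbl ⟩
    12 * (e + (3 * s * t + d)) ^ 2 + (6 * ∣ s ^ 2 - 3 * t ^ 2 ∣) ^ 2 ∎
    where
    open ≡-Reasoning
    l₁ : ∀ e f → 9 * (e * (e * 1)) * (f * (f * 1)) ≡ 9 * ((e * f) * ((e * f) * 1))
    l₁ = solve-∀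
    l₂ : ∀ c → 9 * ((2 * c) * ((2 * c) * 1)) ≡ 36 * (c * (c * 1))
    l₂ = solve-∀
    l₃ : ∀ s t k → 36 * ((k * (k * 1)) + 4 * ((s * (s * 1)) * (3 * (t * (t * 1))))) ≡
                   12 * ((3 * s * t + 3 * s * t) * ((3 * s * t + 3 * s * t) * 1)) + ((6 * k) * ((6 * k) * 1))
    l₃ = solve-∀
    l₄ : ∀ d e → (d * (d * 1)) + e * ((e + d) + d) ≡ ((e + d) * ((e + d) * 1))
    l₄ = solve-∀
    l₅ : ∀ s t → ((3 * s * t) * ((3 * s * t) * 1)) ≡ 9 * (s * (s * 1)) * (t * (t * 1))
    l₅ = solve-∀
    l₆ : ∀ e d → (e + d) + (e + d) ≡ e + ((e + d) + d)
    l₆ = solve-∀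
    prod : e * (3 * s * t + d) ≡ 2 * (s ^ 2 + 3 * t ^ 2)
    prod = +-cancelˡ-≡ (d ^ 2) _ _
      (trans (subst (λ z → d ^ 2 + e * (z + d) ≡ z ^ 2) sum (l₄ d e)) (trans (l₅ s t) (sym disc)))
    dbl : 3 * s * t + 3 * s * t ≡ e + (3 * s * t + d)
    dbl = subst (λ z → z + z ≡ e + (z + d)) sum (l₆ e d)

π : 𝒮 → 𝒯
π x = record
  { a = 3 * s * t ∸ √disc s t
  ; b = 3 * s * t + √disc s t
  ; a>0 = m<n⇒0<n∸m (√disc<3st x)
  ; a<b = ≤-<-trans (m∸n≤m (3 * s * t) (√disc s t)) (m<m+n (3 * s * t) (√disc>0 x))
  ; square = 6 * ∣ s ^ 2 - 3 * t ^ 2 ∣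
           , square-lemma s t (3 * s * t ∸ √disc s t) (√disc s t) (√disc-exact x) (m∸n+n≡m (<⇒≤ (√disc<3st x)))
  }
  where open 𝒮 x

π-cong : ∀ x y → 𝒮.s x ≡ 𝒮.s y → 𝒮.t x ≡ 𝒮.t y → π x ≡ π y
π-cong x y p q = 𝒯-≡
  (cong₂ (λ s t → 3 * s * t ∸ √disc s t) p q) (cong₂ (λ s t → 3 * s * t + √disc s t) p q)

φ-φ-s : ∀ i x → 𝒮.s (φ i (φ i x)) ≡ 𝒮.s x
φ-φ-s zero       x = Vieta-s.jump-jump x
φ-φ-s (suc zero) x = refl

φ-φ-t : ∀ i x → 𝒮.t (φ i (φ i x)) ≡ 𝒮.t x
φ-φ-t zero       x = refl
φ-φ-t (suc zero) x = Vieta-t.jump-jump x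

π-φ-φ : ∀ i x → π (φ i (φ i x)) ≡ π x
π-φ-φ i x = π-cong (φ i (φ i x)) x (φ-φ-s i x) (φ-φ-t i x)

Edge : 𝒯 → 𝒯 → Set
Edge v w = v ≢ w × (∃[ x ] ∃[ i ] π x ≡ v × π (φ i x) ≡ w)

𝒯-graph : SimpleGraph
𝒯-graph = record
  { Vertex     = 𝒯
  ; Adj        = Edge
  ; adj-sym    = λ { (v≢w , x , i , p , q) → v≢w ∘ sym , φ i x , i , q , trans (π-φ-φ i x) p }
  ; adj-irrefl = λ e → proj₁ e refl
  }

root : 𝒯
root = record { a = 2 ; b = 4 ; a>0 = s≤s z≤n ; a<b = s≤s (s≤s (s≤s z≤n)) ; square = 12 , refl }

-- The graphs of the maps φᵢ and ψᵢ on 𝒯: with a = 2q and b = 2r,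
-- φᵢ(a,b) = π(φᵢ(s,t,q)) and ψᵢ(a,b) = π(φᵢ(s,t,r)), where x = (s,t,q), resp.
-- x = (s,t,r), is the point of 𝒮 above (a,b) with that third coordinate.
VarphiGraph PsiGraph : Fin 2 → 𝒯 → 𝒯 → Set
VarphiGraph i v w = ∃[ x ] 𝒯.a v ≡ 2 * 𝒮.u x × π x ≡ v × π (φ i x) ≡ w
PsiGraph    i v w = ∃[ x ] 𝒯.b v ≡ 2 * 𝒮.u x × π x ≡ v × π (φ i x) ≡ w

_IsTheMap_ : (𝒯 → 𝒯) → (𝒯 → 𝒯 → Set) → Set
f IsTheMap R = ∀ v w → f v ≡ w ⇔ R v w

data Generated (varphi psi : Fin 2 → 𝒯 → 𝒯) : 𝒯 → Set where
  start       : Generated varphi psi root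
  step-varphi : ∀ i {v} → Generated varphi psi v → Generated varphi psi (varphi i v)
  step-psi    : ∀ i {v} → Generated varphi psi v → Generated varphi psi (psi i v)

{-# OPTIONS --safe #-}
-- The vertices are the fibres of π, and a + b = 6st. The neighbours of a vertex
-- are the images under φ₁ and φ₂ of the two points of its fibre. Those of the point
-- of larger u have larger a + b, and at most one of the other two does not. A
-- vertex of maximal a + b on a cycle would have two distinct neighbours of which
-- neither has larger a + b, so there are no cycles.
--
-- Surjectivity of π and connectedness come from one Vieta descent on solutions of
-- X + Y + a² = 3aw, XY = 3w². (At a point of 𝒮, a = 2u, w = 2st and X, Y are 2s²
-- and 6t² in some order.) If no jump decreases the solution, each of X, Y, a² is
-- at most the sum of the other two, and (X + Y + a²)² = 3XYa² then forces the
-- smallest to be at most 3. The only such solution is {X, Y} = {2, 6}, a = w = 2,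
-- the point (1,1,1) of 𝒮.
module Submission where

open import Defs
open import Data.Fin.Base using (Fin; zero; suc; inject₁; fromℕ; toℕ)
open import Data.Fin.Properties using (toℕ-inject₁)
open import Data.Fin.Relation.Unary.Top using (view; ‵fromℕ; ‵inject₁)
open import Data.Nat.Base
open import Data.Nat.Coprimality using (1-coprimeTo)
open import Data.Nat.Divisibility using (_∣_; _∣?_; divides; quotient; ∣m+n∣m⇒∣n; m∣m*n)
open import Data.Nat.Induction using (<-wellFounded; Acc; acc)
open import Data.Nat.Primality using (Prime; prime?; euclidsLemma)
open import Data.Nat.Properties
open import Data.Nat.Tactic.RingSolver using (solve-∀)
open import Data.Product.Base using (Σ-syntax; ∃-syntax; _×_; _,_; proj₁; proj₂)
open import Data.Sum.Base as Sum using (_⊎_; inj₁; inj₂; [_,_]′; reduce)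
open import Function.Base using (_∘_; id)
open import Function.Bundles using (mk⇔; mk↣)
open import Function.Definitions using (Injective)
open import Relation.Nullary.Decidable using (Dec; yes; no; from-yes; from-no)
open import Relation.Nullary.Negation.Core using (¬_; contradiction)
open import Relation.Binary.Construct.Closure.ReflexiveTransitive using (Star; ε; _◅_; _◅◅_; reverse)
open import Relation.Binary.Definitions using (Tri; tri<; tri≈; tri>)
open import Relation.Binary.PropositionalEquality.Core
  using (_≡_; _≢_; refl; sym; trans; cong; cong₂; subst)
open import Relation.Binary.PropositionalEquality.Properties using (module ≡-Reasoning)

-- Elementary arithmetic of sums, products and differences.

-- Writing `p′ = p + δ`, the sums force `q = δ + q′` and the products then leave `δ * p = δ * q′`;
-- so `δ = 0` or `p = q′`. The other order is symmetric.
vieta-unique : ∀ {p q p′ q′} → p + q ≡ p′ + q′ → p * q ≡ p′ * q′ → p ≡ p′ ⊎ p ≡ q′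
vieta-unique {p} {q} {p′} {q′} sum prod with ≤-total p p′
... | inj₁ p≤p′
  with δ , refl ← m≤n⇒∃[o]m+o≡n p≤p′
  with refl ← +-cancelˡ-≡ p q _ (trans sum (+-assoc p δ q′))
  = case δ (+-cancelʳ-≡ (p * q′) _ _ (trans (l p q′ δ) (trans prod (r p q′ δ))))
  where
  l : ∀ p q′ δ → δ * p + p * q′ ≡ p * (δ + q′)
  l = solve-∀
  r : ∀ p q′ δ → (p + δ) * q′ ≡ δ * q′ + p * q′
  r = solve-∀
  case : ∀ δ → δ * p ≡ δ * q′ → p ≡ p + δ ⊎ p ≡ q′
  case zero    _ = inj₁ (sym (+-identityʳ p))
  case (suc δ) e = inj₂ (*-cancelˡ-≡ p q′ (suc δ) e)
... | inj₂ p′≤p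
  with δ , refl ← m≤n⇒∃[o]m+o≡n p′≤p
  with refl ← +-cancelˡ-≡ p′ (δ + q) q′ (trans (sym (+-assoc p′ δ q)) sum)
  = case δ (+-cancelʳ-≡ (p′ * q) _ _ (trans (l p′ q δ) (trans prod (r p′ q δ))))
  where
  l : ∀ p′ q δ → δ * q + p′ * q ≡ (p′ + δ) * q
  l = solve-∀
  r : ∀ p′ q δ → p′ * (δ + q) ≡ δ * p′ + p′ * q
  r = solve-∀
  case : ∀ δ → δ * q ≡ δ * p′ → p′ + δ ≡ p′ ⊎ p′ + δ ≡ δ + q
  case zero    _ = inj₁ (+-identityʳ p′)
  case (suc δ) e = inj₂ (trans (+-comm p′ (suc δ)) (cong (suc δ +_) (sym (*-cancelˡ-≡ q p′ (suc δ) e))))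

-- Produces the second root in a Vieta jump, where the inequality is at hand only after
-- multiplication by `m`.
positive-difference : ∀ m {x y} → m * x < m * y → ∃[ d ] 0 < d × x + d ≡ y
positive-difference m {x} {y} lt = y ∸ x , m<n⇒0<n∸m x<y , m+[n∸m]≡n (<⇒≤ x<y)
  where
  x<y : x < y
  x<y = *-cancelˡ-< m x y lt

*-pos : ∀ {m n} → 0 < m → 0 < n → 0 < m * n
*-pos = *-mono-≤ {1} {_} {1}

-- Vieta jumps on the auxiliary equations.

-- The form is symmetric in `X` and `Y`, so a single jump serves for both `φ₁` and `φ₂`. That `X`,
-- `Y` come from coprime `s`, `t` is an outcome of the descent.
record Quad (X Y a w : ℕ) : Set where
  field
    X>0  : 0 < X
    Y>0  : 0 < Y
    a>0  : 0 < a
    w>0  : 0 < w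
    prod : X * Y ≡ 3 * (w * w)
    sum  : X + Y + a * a ≡ 3 * (a * w)

swap-Quad : ∀ {X Y a w} → Quad X Y a w → Quad Y X a w
swap-Quad {X} {Y} {a} Q = record
  { X>0 = Y>0 ; Y>0 = X>0 ; a>0 = a>0 ; w>0 = w>0
  ; prod = trans (*-comm Y X) prod ; sum = trans (cong (_+ a * a) (+-comm Y X)) sum }
  where open Quad Q

module _ {X Y a w : ℕ} (Q : Quad X Y a w) where
  open Quad Q

  -- As a quadratic in `a`, `sum` has roots with sum `3w` and product `X + Y`; positivity of the
  -- product gives `a < 3w`.
  jump-a : ∃[ b ] a + b ≡ 3 * w × a * b ≡ X + Y × Quad X Y b w
  jump-a with positive-difference a {a} {3 * w} lt
    where
    eq : a * a + (X + Y) ≡ a * (3 * w)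
    eq = trans (+-comm (a * a) (X + Y)) (trans sum (l a w))
      where
      l : ∀ a w → 3 * (a * w) ≡ a * (3 * w)
      l = solve-∀
    lt : a * a < a * (3 * w)
    lt = subst (a * a <_) eq (m<m+n (a * a) (≤-trans X>0 (m≤m+n X Y)))
  ... | b , b>0 , a+b = b , a+b , ab , record
    { X>0 = X>0 ; Y>0 = Y>0 ; a>0 = b>0 ; w>0 = w>0 ; prod = prod
    ; sum = begin
        X + Y + b * b  ≡⟨ cong (_+ b * b) (sym ab) ⟩
        a * b + b * b  ≡⟨ l₂ a b ⟩
        b * (a + b)    ≡⟨ cong (b *_) a+b ⟩
        b * (3 * w)    ≡⟨ l₁ b w ⟩
        3 * (b * w)    ∎
    }
    where
    open ≡-Reasoning
    l₁ : ∀ a w → a * (3 * w) ≡ 3 * (a * w)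
    l₁ = solve-∀
    l₂ : ∀ a b → a * b + b * b ≡ b * (a + b)
    l₂ = solve-∀
    l₃ : ∀ a b → a * b + a * a ≡ a * (a + b)
    l₃ = solve-∀
    ab : a * b ≡ X + Y
    ab = +-cancelʳ-≡ (a * a) _ _ (begin
      a * b + a * a  ≡⟨ l₃ a b ⟩
      a * (a + b)    ≡⟨ cong (a *_) a+b ⟩
      a * (3 * w)    ≡⟨ l₁ a w ⟩
      3 * (a * w)    ≡⟨ sym sum ⟩
      X + Y + a * a  ∎)

  -- Multiplying `sum` by `X` and putting `3w²` for `XY` gives `3w² + X(X + a²) = 3aXw`, a quadratic
  -- in `w` with second root `w′ = aX - w`. `Y′` is read off `sum` at `w′`; it is positive because
  -- `X` times it is `3w′²`.
  jump-Y : ∃[ Y′ ] ∃[ w′ ] w + w′ ≡ a * X × X * (X + a * a) ≡ 3 * (w * w′) × Quad X Y′ a w′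
  jump-Y =
    let w′ , w′>0 , w+w′ = positive-difference (3 * w) {w} {a * X} w<aX
        Y′ , Y′>0 , sum′ = positive-difference X (Y′>0-scaled w′ w′>0 w+w′)
    in Y′ , w′ , w+w′ , 3ww′ w′ w+w′ , record
      { X>0 = X>0 ; Y>0 = Y′>0 ; a>0 = a>0 ; w>0 = w′>0
      ; prod = prod′ w′ Y′ w+w′ sum′
      ; sum  = trans (l₅ X Y′ a) sum′ }
    where
    open ≡-Reasoning
    l₁ : ∀ X Y a → X * Y + X * (X + a * a) ≡ X * (X + Y + a * a)
    l₁ = solve-∀
    l₂ : ∀ X a w → X * (3 * (a * w)) ≡ 3 * w * (a * X)
    l₂ = solve-∀
    l₃ : ∀ w w′ → 3 * w * w + 3 * (w * w′) ≡ 3 * w * (w + w′)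
    l₃ = solve-∀
    l₄ : ∀ w w′ → 3 * (w * w′) + 3 * (w′ * w′) ≡ 3 * w′ * (w + w′)
    l₄ = solve-∀
    l₅ : ∀ X Y a → X + Y + a * a ≡ X + a * a + Y
    l₅ = solve-∀
    eq : 3 * w * w + X * (X + a * a) ≡ 3 * w * (a * X)
    eq = begin
      3 * w * w + X * (X + a * a)  ≡⟨ cong (_+ X * (X + a * a)) (trans (*-assoc 3 w w) (sym prod)) ⟩
      X * Y + X * (X + a * a)      ≡⟨ l₁ X Y a ⟩
      X * (X + Y + a * a)          ≡⟨ cong (X *_) sum ⟩
      X * (3 * (a * w))            ≡⟨ l₂ X a w ⟩
      3 * w * (a * X)              ∎
    w<aX : 3 * w * w < 3 * w * (a * X)
    w<aX = subst (3 * w * w <_) eq (m<m+n (3 * w * w) (*-pos X>0 (≤-trans X>0 (m≤m+n X (a * a)))))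

    module _ (w′ : ℕ) where
      3ww′ : w + w′ ≡ a * X → X * (X + a * a) ≡ 3 * (w * w′)
      3ww′ w+w′ = +-cancelˡ-≡ (3 * w * w) _ _
        (trans eq (trans (cong (3 * w *_) (sym w+w′)) (sym (l₃ w w′))))
      eq′ : w + w′ ≡ a * X → X * (X + a * a) + 3 * (w′ * w′) ≡ X * (3 * (a * w′))
      eq′ w+w′ = begin
        X * (X + a * a) + 3 * (w′ * w′)  ≡⟨ cong (_+ 3 * (w′ * w′)) (3ww′ w+w′) ⟩
        3 * (w * w′) + 3 * (w′ * w′)     ≡⟨ l₄ w w′ ⟩
        3 * w′ * (w + w′)                ≡⟨ cong (3 * w′ *_) w+w′ ⟩
        3 * w′ * (a * X)                 ≡⟨ sym (l₂ X a w′) ⟩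
        X * (3 * (a * w′))               ∎
      Y′>0-scaled : 0 < w′ → w + w′ ≡ a * X → X * (X + a * a) < X * (3 * (a * w′))
      Y′>0-scaled w′>0 w+w′ = subst (X * (X + a * a) <_) (eq′ w+w′)
        (m<m+n (X * (X + a * a)) (*-pos {3} (s≤s z≤n) (*-pos w′>0 w′>0)))
      prod′ : ∀ Y′ → w + w′ ≡ a * X → X + a * a + Y′ ≡ 3 * (a * w′) → X * Y′ ≡ 3 * (w′ * w′)
      prod′ Y′ w+w′ sum′ = +-cancelˡ-≡ (X * (X + a * a)) _ _ (begin
        X * (X + a * a) + X * Y′         ≡⟨ sym (*-distribˡ-+ X (X + a * a) Y′) ⟩
        X * (X + a * a + Y′)             ≡⟨ cong (X *_) sum′ ⟩
        X * (3 * (a * w′))               ≡⟨ sym (eq′ w+w′) ⟩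
        X * (X + a * a) + 3 * (w′ * w′)  ∎)

-- Solutions that no jump decreases.

-- With M ≤ z = M + δ and δ ≤ M: (m + M + z)² ≤ (3M + δ)² ≤ 9M(M + δ) = 9Mz.
min-bound : ∀ {m M z} → 0 < M → m ≤ M → M ≤ z → z ≤ m + M →
            (m + M + z) * (m + M + z) ≡ 3 * (m * (M * z)) → m ≤ 3
min-bound {m} {M} {z} M>0 m≤M M≤z z≤m+M eq with δ , refl ← m≤n⇒∃[o]m+o≡n M≤z =
  *-cancelʳ-≤ m 3 (3 * (M * z)) {{>-nonZero (*-pos {3} (s≤s z≤n) (*-pos M>0 (≤-trans M>0 M≤z)))}} (begin
    m * (3 * (M * z))                           ≡⟨ l₁ m (M * z) ⟩
    3 * (m * (M * z))                           ≡⟨ sym eq ⟩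
    (m + M + z) * (m + M + z)                   ≤⟨ *-mono-≤ sz sz ⟩
    (M + M + z) * (M + M + z)                   ≡⟨ l₂ M δ ⟩
    9 * (M * M) + 6 * (M * δ) + δ * δ           ≤⟨ +-monoʳ-≤ (9 * (M * M) + 6 * (M * δ)) (*-monoˡ-≤ δ δ≤3M) ⟩
    9 * (M * M) + 6 * (M * δ) + 3 * M * δ       ≡⟨ l₃ M δ ⟩
    3 * (3 * (M * z))                           ∎)
  where
  open ≤-Reasoning
  l₁ : ∀ m n → m * (3 * n) ≡ 3 * (m * n)
  l₁ = solve-∀
  l₂ : ∀ M δ → (M + M + (M + δ)) * (M + M + (M + δ)) ≡ 9 * (M * M) + 6 * (M * δ) + δ * δ
  l₂ = solve-∀
  l₃ : ∀ M δ → 9 * (M * M) + 6 * (M * δ) + 3 * M * δ ≡ 3 * (3 * (M * (M + δ)))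
  l₃ = solve-∀
  sz : m + M + z ≤ M + M + z
  sz = +-monoˡ-≤ z (+-monoˡ-≤ M m≤M)
  δ≤3M : δ ≤ 3 * M
  δ≤3M = ≤-trans (+-cancelˡ-≤ M δ m (subst (z ≤_) (+-comm m M) z≤m+M)) (≤-trans m≤M (m≤n*m M 3))

4mn≤[m+n]² : ∀ m n → 4 * (m * n) ≤ (m + n) * (m + n)
4mn≤[m+n]² m n = begin
  4 * (m * n)                  ≤⟨ m≤n+m _ (∣ m - n ∣ ^ 2) ⟩
  ∣ m - n ∣ ^ 2 + 4 * (m * n)  ≡⟨ ∣-∣^2-+ m n ⟩
  (m + n) ^ 2                  ≡⟨ cong ((m + n) *_) (*-identityʳ (m + n)) ⟩
  (m + n) * (m + n)            ∎
  where open ≤-Reasoning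

-- Excludes a term equal to 1 from `(x + y + z)² = 3xyz`: the left side exceeds `(m + n)² ≥ 4mn`.
no-unit : ∀ m n → (1 + (m + n)) * (1 + (m + n)) ≢ 3 * (m * n)
no-unit m n eq = <-irrefl (sym eq) (begin-strict
  3 * (m * n)                      ≤⟨ *-monoˡ-≤ (m * n) {3} {4} (n≤1+n 3) ⟩
  4 * (m * n)                      ≤⟨ 4mn≤[m+n]² m n ⟩
  (m + n) * (m + n)                <⟨ *-mono-< (n<1+n (m + n)) (n<1+n (m + n)) ⟩
  (1 + (m + n)) * (1 + (m + n))    ∎)
  where open ≤-Reasoning

-- The next square after `m²` is larger by `2m + 1 ≥ 5`.
square-gap : ∀ {m n} → 2 ≤ m → n * n ≤ 3 + m * m → n ≤ m
square-gap {m} {n} 2≤m le = ≮⇒≥ λ m<n → <-irrefl refl (begin-strict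
    3 + m * m            <⟨ +-monoˡ-< (m * m) (≤-trans (n≤1+n 4) (s≤s (*-monoʳ-≤ 2 2≤m))) ⟩
    1 + 2 * m + m * m    ≡⟨ l m ⟩
    suc m * suc m        ≤⟨ *-mono-≤ m<n m<n ⟩
    n * n                ≤⟨ le ⟩
    3 + m * m            ∎)
  where
  open ≤-Reasoning
  l : ∀ m → 1 + 2 * m + m * m ≡ (1 + m) * (1 + m)
  l = solve-∀

square≢3 : ∀ n → n * n ≢ 3
square≢3 1 ()
square≢3 (suc (suc n)) e = contradiction
  (subst (4 ≤_) e (*-mono-≤ {2} {2 + n} {2} {2 + n} (s≤s (s≤s z≤n)) (s≤s (s≤s z≤n))))
  λ { (s≤s (s≤s (s≤s ()))) }

-- The case `X = 3`, where `Y = w²`: the two bounds force `a = w`, and the equation becomes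
-- `a² = 3`.
no-three : ∀ {a w} → 2 ≤ a → 2 ≤ w → w * w ≤ 3 + a * a → a * a ≤ 3 + w * w →
           3 + w * w + a * a ≢ 3 * (a * w)
no-three {a} {w} 2≤a 2≤w w²≤ a²≤ eq
  with refl ← ≤-antisym (square-gap 2≤w a²≤) (square-gap 2≤a w²≤) =
  square≢3 a (+-cancelʳ-≡ (2 * (a * a)) _ _ (trans (l a) (trans (sym eq) (r a))))
  where
  l : ∀ a → a * a + 2 * (a * a) ≡ 3 * (a * a)
  l = solve-∀
  r : ∀ a → 3 + a * a + a * a ≡ 3 + 2 * (a * a)
  r = solve-∀

-- In terms of f = 3w - 2a the equation is 12 + f² = 2a² + 2af, and the bound on
-- w² gives af ≤ 4.
only-two : ∀ {a w} → 2 ≤ a → 3 * (w * w) ≤ 4 + 2 * (a * a) → 2 * (a * a) ≤ 4 + 3 * (w * w) →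
           4 + 3 * (w * w) + 2 * (a * a) ≡ 6 * (a * w) → a ≡ 2 × w ≡ 2
only-two {a} {w} 2≤a w²≤ a²≤ eq = solve f 2a+f af≤4 f-eq
  where
  2a≤3w : 2 * a ≤ 3 * w
  2a≤3w = *-cancelˡ-≤ (2 * a) {{>-nonZero (*-pos {2} (s≤s z≤n) (<⇒≤ 2≤a))}} (begin
    2 * a * (2 * a)                        ≡⟨ l a ⟩
    2 * (a * a) + 2 * (a * a)              ≤⟨ +-monoˡ-≤ (2 * (a * a)) a²≤ ⟩
    4 + 3 * (w * w) + 2 * (a * a)          ≡⟨ eq ⟩
    6 * (a * w)                            ≡⟨ r a w ⟩
    2 * a * (3 * w)                        ∎)
    where
    open ≤-Reasoning
    l : ∀ a → 2 * a * (2 * a) ≡ 2 * (a * a) + 2 * (a * a)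
    l = solve-∀
    r : ∀ a w → 6 * (a * w) ≡ 2 * a * (3 * w)
    r = solve-∀
  f : ℕ
  f = 3 * w ∸ 2 * a
  2a+f : 2 * a + f ≡ 3 * w
  2a+f = m+[n∸m]≡n 2a≤3w
  af≤4 : a * f ≤ 4
  af≤4 = *-cancelˡ-≤ 2 (+-cancelˡ-≤ (4 * (a * a)) _ _ (begin
    4 * (a * a) + 2 * (a * f)              ≡⟨ l a f ⟩
    2 * a * (2 * a + f)                    ≡⟨ cong (2 * a *_) 2a+f ⟩
    2 * a * (3 * w)                        ≡⟨ m a w ⟩
    6 * (a * w)                            ≡⟨ sym eq ⟩
    4 + 3 * (w * w) + 2 * (a * a)          ≤⟨ +-monoˡ-≤ (2 * (a * a)) (+-monoʳ-≤ 4 w²≤) ⟩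
    4 + (4 + 2 * (a * a)) + 2 * (a * a)    ≡⟨ r a ⟩
    4 * (a * a) + 8                        ∎))
    where
    open ≤-Reasoning
    l : ∀ a f → 4 * (a * a) + 2 * (a * f) ≡ 2 * a * (2 * a + f)
    l = solve-∀
    m : ∀ a w → 2 * a * (3 * w) ≡ 6 * (a * w)
    m = solve-∀
    r : ∀ a → 4 + (4 + 2 * (a * a)) + 2 * (a * a) ≡ 4 * (a * a) + 8
    r = solve-∀
  f-eq : 12 + f * f ≡ 2 * (a * a) + 2 * (a * f)
  -- Three times `eq`, with `3w = 2a + f`; adding `4af + 10a²` completes the square without
  -- subtraction.
  f-eq = +-cancelˡ-≡ (4 * (a * f) + 10 * (a * a)) _ _ (begin
    4 * (a * f) + 10 * (a * a) + (12 + f * f)                     ≡⟨ l a f ⟩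
    12 + (2 * a + f) * (2 * a + f) + 6 * (a * a)                  ≡⟨ cong (λ z → 12 + z * z + 6 * (a * a)) 2a+f ⟩
    12 + 3 * w * (3 * w) + 6 * (a * a)                            ≡⟨ m a w ⟩
    3 * (4 + 3 * (w * w) + 2 * (a * a))                           ≡⟨ cong (3 *_) eq ⟩
    3 * (6 * (a * w))                                             ≡⟨ m′ a w ⟩
    6 * a * (3 * w)                                               ≡⟨ cong (6 * a *_) (sym 2a+f) ⟩
    6 * a * (2 * a + f)                                           ≡⟨ r a f ⟩
    4 * (a * f) + 10 * (a * a) + (2 * (a * a) + 2 * (a * f))      ∎)
    where
    open ≡-Reasoning
    l : ∀ a f → 4 * (a * f) + 10 * (a * a) + (12 + f * f) ≡ 12 + (2 * a + f) * (2 * a + f) + 6 * (a * a)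
    l = solve-∀
    m : ∀ a w → 12 + 3 * w * (3 * w) + 6 * (a * a) ≡ 3 * (4 + 3 * (w * w) + 2 * (a * a))
    m = solve-∀
    m′ : ∀ a w → 3 * (6 * (a * w)) ≡ 6 * a * (3 * w)
    m′ = solve-∀
    r : ∀ a f → 6 * a * (2 * a + f) ≡ 4 * (a * f) + 10 * (a * a) + (2 * (a * a) + 2 * (a * f))
    r = solve-∀
  solve : ∀ f → 2 * a + f ≡ 3 * w → a * f ≤ 4 → 12 + f * f ≡ 2 * (a * a) + 2 * (a * f) → a ≡ 2 × w ≡ 2
  solve f 2a+f af≤4 f-eq with m≤n⇒m<n∨m≡n 2≤a
  ... | inj₁ 3≤a = contradiction f-eq (<⇒≢ (begin-strict
      12 + f * f                    ≤⟨ +-monoʳ-≤ 12 (*-mono-≤ f≤1 f≤1) ⟩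
      13                            <⟨ m≤n+m 14 4 ⟩
      18                            ≤⟨ *-monoʳ-≤ 2 (*-mono-≤ 3≤a 3≤a) ⟩
      2 * (a * a)                   ≤⟨ m≤m+n _ _ ⟩
      2 * (a * a) + 2 * (a * f)     ∎))
    where
    open ≤-Reasoning
    f≤1 : f ≤ 1
    f≤1 = ≮⇒≥ λ 2≤f → contradiction (≤-trans (*-mono-≤ 3≤a 2≤f) af≤4)
      λ { (s≤s (s≤s (s≤s (s≤s ())))) }
  ... | inj₂ refl = at-two f 2a+f af≤4 f-eq
    where
    at-two : ∀ f → 4 + f ≡ 3 * w → 2 * f ≤ 4 → 12 + f * f ≡ 8 + 2 * (2 * f) → 2 ≡ 2 × w ≡ 2
    at-two 0 _ _ ()
    at-two 1 _ _ ()
    at-two 2 e _ _ = refl , *-cancelˡ-≡ w 2 3 (sym e)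
    at-two (suc (suc (suc f))) _ le _ = contradiction (≤-trans (*-monoʳ-≤ 2 {3} (s≤s (s≤s (s≤s z≤n)))) le)
      λ { (s≤s (s≤s (s≤s (s≤s ())))) }

-- Here `(X + Y + a²)² = 3XYa²`, and `no-unit` gives `X ≥ 2` and `a² ≥ 4`. The least of the three
-- terms is at most 3 by `min-bound`, so it is `X`, which is 2 or 3; `only-two` and `no-three`
-- settle these values.
fundamental : ∀ {X Y a w} → Quad X Y a w → X ≤ Y → Y ≤ X + a * a → a * a ≤ X + Y →
              X ≡ 2 × a ≡ 2 × w ≡ 2
fundamental {X} {Y} {a} {w} Q X≤Y Y≤ a²≤ = small X 2≤X (≮⇒≥ X≮) Q X≤Y Y≤ a²≤
  where
  open Quad Q
  norm : (X + Y + a * a) * (X + Y + a * a) ≡ 3 * (X * (Y * (a * a)))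
  norm = begin
    (X + Y + a * a) * (X + Y + a * a)  ≡⟨ cong₂ _*_ sum sum ⟩
    3 * (a * w) * (3 * (a * w))        ≡⟨ l a w ⟩
    3 * (3 * (w * w) * (a * a))        ≡⟨ cong (λ z → 3 * (z * (a * a))) (sym prod) ⟩
    3 * (X * Y * (a * a))              ≡⟨ cong (3 *_) (*-assoc X Y (a * a)) ⟩
    3 * (X * (Y * (a * a)))            ∎
    where
    open ≡-Reasoning
    l : ∀ a w → 3 * (a * w) * (3 * (a * w)) ≡ 3 * (3 * (w * w) * (a * a))
    l = solve-∀

  2≤a : 2 ≤ a
  2≤a = ≤∧≢⇒< a>0 λ { refl → no-unit X Y (trans (l X Y) (trans norm (r X Y))) }
    where
    l : ∀ X Y → (1 + (X + Y)) * (1 + (X + Y)) ≡ (X + Y + 1 * 1) * (X + Y + 1 * 1)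
    l = solve-∀
    r : ∀ X Y → 3 * (X * (Y * (1 * 1))) ≡ 3 * (X * Y)
    r = solve-∀

  2≤X : 2 ≤ X
  2≤X = ≤∧≢⇒< X>0 λ { refl → no-unit Y (a * a) (trans norm (cong (3 *_) (*-identityˡ (Y * (a * a))))) }

  X≮ : ¬ 3 < X
  -- As `X ≤ Y`, the cases place `a²` last, in the middle and first in the order of the three terms.
  X≮ 4≤X with ≤-total Y (a * a) | ≤-total X (a * a)
  ... | inj₁ Y≤Z | _ = contradiction (min-bound Y>0 X≤Y Y≤Z a²≤ norm) (<⇒≱ 4≤X)
  ... | inj₂ Z≤Y | inj₁ X≤Z = contradiction (min-bound (*-pos a>0 a>0) X≤Z Z≤Y Y≤
      (trans (l X Y (a * a)) (trans norm (r X Y (a * a))))) (<⇒≱ 4≤X)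
    where
    l : ∀ X Y Z → (X + Z + Y) * (X + Z + Y) ≡ (X + Y + Z) * (X + Y + Z)
    l = solve-∀
    r : ∀ X Y Z → 3 * (X * (Y * Z)) ≡ 3 * (X * (Z * Y))
    r = solve-∀
  ... | inj₂ _ | inj₂ Z≤X = contradiction (min-bound X>0 Z≤X X≤Y (subst (Y ≤_) (+-comm X (a * a)) Y≤)
      (trans (l X Y (a * a)) (trans norm (r X Y (a * a))))) (<⇒≱ (*-mono-≤ 2≤a 2≤a))
    where
    l : ∀ X Y Z → (Z + X + Y) * (Z + X + Y) ≡ (X + Y + Z) * (X + Y + Z)
    l = solve-∀
    r : ∀ X Y Z → 3 * (X * (Y * Z)) ≡ 3 * (Z * (X * Y))
    r = solve-∀

  -- `X` is generalised so that matching on its value turns `prod` into `2Y = 3w²` or `3Y = 3w²`.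
  small : ∀ X → 2 ≤ X → X ≤ 3 → Quad X Y a w → X ≤ Y → Y ≤ X + a * a → a * a ≤ X + Y → X ≡ 2 × a ≡ 2 × w ≡ 2
  small 1 (s≤s ())
  small 2 _ _ Q _ Y≤ a²≤ = refl , only-two 2≤a
      (subst (_≤ 4 + 2 * (a * a)) prod₂ (≤-trans (*-monoʳ-≤ 2 Y≤) (≤-reflexive (*-distribˡ-+ 2 2 (a * a)))))
      (≤-trans (*-monoʳ-≤ 2 a²≤) (≤-reflexive (trans (*-distribˡ-+ 2 2 Y) (cong (4 +_) prod₂))))
      (trans (cong (λ z → 4 + z + 2 * (a * a)) (sym prod₂)) (trans (l Y a) (trans (cong (2 *_) (Quad.sum Q)) (r a w))))
    where
    prod₂ : 2 * Y ≡ 3 * (w * w)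
    prod₂ = Quad.prod Q
    l : ∀ Y a → 4 + 2 * Y + 2 * (a * a) ≡ 2 * (2 + Y + a * a)
    l = solve-∀
    r : ∀ a w → 2 * (3 * (a * w)) ≡ 6 * (a * w)
    r = solve-∀
  small 3 _ _ Q 3≤Y Y≤ a²≤ with refl ← *-cancelˡ-≡ Y (w * w) 3 (Quad.prod Q) =
    contradiction (Quad.sum Q) (no-three 2≤a 2≤w Y≤ a²≤)
    where
    2≤w : 2 ≤ w
    2≤w = ≮⇒≥ λ { (s≤s w≤1) → contradiction (≤-trans 3≤Y (*-mono-≤ w≤1 w≤1)) λ { (s≤s ()) } }
  small (suc (suc (suc (suc X)))) _ (s≤s (s≤s (s≤s ())))

-- Descent, and lifting solutions to points of `𝒮`.

φ₃ : 𝒮 → 𝒮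
φ₃ x = record
  { s = s ; t = t ; u = 3 * s * t ∸ u
  ; s>0 = s>0 ; t>0 = t>0 ; u>0 = jump>0
  ; coprime  = coprime
  ; equation = trans (l s t (3 * s * t ∸ u)) (trans jump-eq (r s t (3 * s * t ∸ u)))
  }
  where
  open 𝒮 x
  open Vieta-u x
  l : ∀ s t u → s * (s * 1) + 3 * (t * (t * 1)) + 2 * (u * (u * 1)) ≡ 2 * (u * (u * 1)) + (s * (s * 1) + 3 * (t * (t * 1)))
  l = solve-∀
  r : ∀ s t u → 2 * (u * (3 * s * t)) ≡ 6 * s * t * u
  r = solve-∀

-- The trace of a descent read upwards; `reach-Generated` turns it into a word in the four maps.
data Reach : 𝒮 → Set where
  base : ∀ {x} → 𝒮.s x ≡ 1 → 𝒮.t x ≡ 1 → Reach x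
  move : ∀ i {x} → Reach x → Reach (φ i x)
  flip : ∀ {x} → Reach x → Reach (φ₃ x)

one : 𝒮
one = mk𝒮 1 1 1 (s≤s z≤n) (s≤s z≤n) (s≤s z≤n) (1-coprimeTo 1) refl

-- The disjunction absorbs the exchanges of `X` and `Y` during the descent; `Y` is then determined
-- by `prod`, as in `swap-Lift`.
record Lift (X a w : ℕ) : Set where
  field
    point : 𝒮
    reach : Reach point
    a≡2u  : a ≡ 2 * 𝒮.u point
    w≡2st : w ≡ 2 * (𝒮.s point * 𝒮.t point)
    X≡    : X ≡ 2 * (𝒮.s point * 𝒮.s point) ⊎ X ≡ 6 * (𝒮.t point * 𝒮.t point)

swap-Lift : ∀ {X Y a w} → Quad X Y a w → Lift X a w → Lift Y a w
swap-Lift {X} {Y} {a} {w} Q L = record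
  { point = point ; reach = reach ; a≡2u = a≡2u ; w≡2st = w≡2st ; X≡ = swap X≡ }
  where
  open Quad Q
  open Lift L
  open 𝒮 point
  l : ∀ s t → 3 * (2 * (s * t) * (2 * (s * t))) ≡ 2 * (s * s) * (6 * (t * t))
  l = solve-∀
  r : ∀ s t → 3 * (2 * (s * t) * (2 * (s * t))) ≡ 6 * (t * t) * (2 * (s * s))
  r = solve-∀
  XY : X * Y ≡ 3 * (2 * (s * t) * (2 * (s * t)))
  XY = trans prod (cong (λ z → 3 * (z * z)) w≡2st)
  cancel : ∀ {Z} → X * Y ≡ X * Z → Y ≡ Z
  cancel = *-cancelˡ-≡ _ _ X {{>-nonZero X>0}}
  swap : X ≡ 2 * (s * s) ⊎ X ≡ 6 * (t * t) → Y ≡ 2 * (s * s) ⊎ Y ≡ 6 * (t * t)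
  swap (inj₁ e) = inj₂ (cancel (trans XY (trans (l s t) (cong (_* (6 * (t * t))) (sym e)))))
  swap (inj₂ e) = inj₁ (cancel (trans XY (trans (r s t) (cong (_* (2 * (s * s))) (sym e)))))

-- With `b = 2u` and `w = 2st`, the relation `a + b = 3w` is twice `u + u′ = 3st`, so the jump in
-- `a` is `φ₃`.
unjump-a : ∀ {X a b w} → a + b ≡ 3 * w → Lift X b w → Lift X a w
unjump-a {X} {a} {b} {w} a+b L = record
  { point = φ₃ point ; reach = flip reach
  ; a≡2u = +-cancelʳ-≡ b _ _ (begin
      a + b                      ≡⟨ a+b ⟩
      3 * w                      ≡⟨ cong (3 *_) w≡2st ⟩
      3 * (2 * (s * t))          ≡⟨ l s t ⟩
      2 * (3 * s * t)            ≡⟨ cong (2 *_) (sym x+jump) ⟩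
      2 * (u + jump)             ≡⟨ r u jump ⟩
      2 * jump + 2 * u           ≡⟨ cong (2 * jump +_) (sym a≡2u) ⟩
      2 * jump + b               ∎)
  ; w≡2st = w≡2st ; X≡ = X≡ }
  where
  open Lift L
  open 𝒮 point
  open Vieta-u point using (jump; x+jump)
  open ≡-Reasoning
  l : ∀ s t → 3 * (2 * (s * t)) ≡ 2 * (3 * s * t)
  l = solve-∀
  r : ∀ u v → 2 * (u + v) ≡ 2 * v + 2 * u
  r = solve-∀

-- If `X = 2s²`, the relation `w + w′ = aX` is `2s` times `t + t′ = 2su`, which is `φ₂`. If
-- `X = 6t²`, it is `2t` times `s + s′ = 6tu`, which is `φ₁`.
unjump-Y : ∀ {X a w w′} → w + w′ ≡ a * X → Lift X a w′ → Lift X a w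
unjump-Y {X} {a} {w} {w′} w+w′ L = go X≡
  where
  open Lift L
  open 𝒮 point
  open ≡-Reasoning
  go : X ≡ 2 * (s * s) ⊎ X ≡ 6 * (t * t) → Lift X a w
  go (inj₁ e) = record
    { point = φ (suc zero) point ; reach = move (suc zero) reach ; a≡2u = a≡2u
    ; w≡2st = +-cancelʳ-≡ w′ _ _ (begin
        w + w′                              ≡⟨ w+w′ ⟩
        a * X                               ≡⟨ cong₂ _*_ a≡2u e ⟩
        2 * u * (2 * (s * s))               ≡⟨ l s u ⟩
        2 * (s * (2 * s * u))               ≡⟨ cong (λ z → 2 * (s * z)) (sym x+jump) ⟩
        2 * (s * (t + jump))                ≡⟨ r s t jump ⟩
        2 * (s * jump) + 2 * (s * t)        ≡⟨ cong (2 * (s * jump) +_) (sym w≡2st) ⟩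
        2 * (s * jump) + w′                 ∎)
    ; X≡ = inj₁ e }
    where
    open Vieta-t point using (jump; x+jump)
    l : ∀ s u → 2 * u * (2 * (s * s)) ≡ 2 * (s * (2 * s * u))
    l = solve-∀
    r : ∀ s t t′ → 2 * (s * (t + t′)) ≡ 2 * (s * t′) + 2 * (s * t)
    r = solve-∀
  go (inj₂ e) = record
    { point = φ zero point ; reach = move zero reach ; a≡2u = a≡2u
    ; w≡2st = +-cancelʳ-≡ w′ _ _ (begin
        w + w′                              ≡⟨ w+w′ ⟩
        a * X                               ≡⟨ cong₂ _*_ a≡2u e ⟩
        2 * u * (6 * (t * t))               ≡⟨ l t u ⟩
        2 * (6 * t * u * t)                 ≡⟨ cong (λ z → 2 * (z * t)) (sym x+jump) ⟩
        2 * ((s + jump) * t)                ≡⟨ r s t jump ⟩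
        2 * (jump * t) + 2 * (s * t)        ≡⟨ cong (2 * (jump * t) +_) (sym w≡2st) ⟩
        2 * (jump * t) + w′                 ∎)
    ; X≡ = inj₂ e }
    where
    open Vieta-s point using (jump; x+jump)
    l : ∀ t u → 2 * u * (6 * (t * t)) ≡ 2 * (6 * t * u * t)
    l = solve-∀
    r : ∀ s t s′ → 2 * ((s + s′) * t) ≡ 2 * (s′ * t) + 2 * (s * t)
    r = solve-∀

-- The jumps to try are those of `a` and of the larger term `Y`. If neither decreases, then
-- `ab = X + Y` with `a ≤ b`, and `X(X + a²) = 3ww′` with `w ≤ w′`, give the two bounds that
-- `fundamental` asks for.
descend-ordered : ∀ {X Y a w} → Quad X Y a w → X ≤ Y →
  (∀ {X′ Y′ a′ w′} → Quad X′ Y′ a′ w′ → X′ + Y′ + a′ < X + Y + a → Lift X′ a′ w′) → Lift X a w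
descend-ordered {X} {Y} {a} {w} Q X≤Y rec = cases (jump-a Q) (jump-Y Q)
  where
  open ≤-Reasoning

  cases : ∃[ b ] a + b ≡ 3 * w × a * b ≡ X + Y × Quad X Y b w →
          ∃[ Y′ ] ∃[ w′ ] w + w′ ≡ a * X × X * (X + a * a) ≡ 3 * (w * w′) × Quad X Y′ a w′ →
          Lift X a w
  cases (b , a+b , ab , Qa) (Y′ , w′ , w+w′ , ww′ , QY) with b <? a | w′ <? w
  ... | yes b<a | _ = unjump-a {X} a+b (rec Qa (+-monoʳ-< (X + Y) b<a))
  ... | no _ | yes w′<w = unjump-Y w+w′ (rec QY (+-monoˡ-< a (+-monoʳ-< X Y′<Y)))
    where
    Y′<Y : Y′ < Y
    Y′<Y = *-cancelˡ-< X Y′ Y (begin-strict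
      X * Y′          ≡⟨ Quad.prod QY ⟩
      3 * (w′ * w′)   <⟨ *-monoʳ-< 3 (*-mono-< w′<w w′<w) ⟩
      3 * (w * w)     ≡⟨ sym (Quad.prod Q) ⟩
      X * Y           ∎)
  ... | no b≮a | no w′≮w = Lift-one (fundamental Q X≤Y Y≤ a²≤)
    where
    a²≤ : a * a ≤ X + Y
    a²≤ = subst (a * a ≤_) ab (*-monoʳ-≤ a (≮⇒≥ b≮a))
    Y≤ : Y ≤ X + a * a
    Y≤ = *-cancelˡ-≤ X {{>-nonZero (Quad.X>0 Q)}} (begin
      X * Y            ≡⟨ Quad.prod Q ⟩
      3 * (w * w)      ≤⟨ *-monoʳ-≤ 3 (*-monoʳ-≤ w (≮⇒≥ w′≮w)) ⟩
      3 * (w * w′)     ≡⟨ sym ww′ ⟩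
      X * (X + a * a)  ∎)
    Lift-one : X ≡ 2 × a ≡ 2 × w ≡ 2 → Lift X a w
    Lift-one (X≡2 , a≡2 , w≡2) = record
      { point = one ; reach = base refl refl ; a≡2u = a≡2 ; w≡2st = w≡2 ; X≡ = inj₁ X≡2 }

descend : ∀ {X Y a w} → Quad X Y a w → Acc _<_ (X + Y + a) → Lift X a w
descend {X} {Y} {a} Q (acc rs) with ≤-total X Y
... | inj₁ X≤Y = descend-ordered Q X≤Y λ Q′ lt → descend Q′ (rs lt)
... | inj₂ Y≤X = swap-Lift (swap-Quad Q) (descend-ordered (swap-Quad Q) Y≤X
  λ {X′} {Y′} {a′} Q′ lt → descend Q′ (rs (subst (X′ + Y′ + a′ <_) (cong (_+ a) (+-comm Y X)) lt)))
 

-- From vertices to solutions of the auxiliary equations.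

prime∣square : ∀ {p} n → Prime p → p ∣ n * n → p ∣ n
prime∣square n pp p∣n² = reduce (euclidsLemma n n pp p∣n²)

prime∣c*square : ∀ {p} c n → Prime p → ¬ p ∣ c → p ∣ c * (n * n) → p ∣ n
prime∣c*square c n pp p∤c p∣cn² with euclidsLemma c (n * n) pp p∣cn²
... | inj₁ p∣c  = contradiction p∣c p∤c
... | inj₂ p∣n² = prime∣square n pp p∣n²

3-prime : Prime 3
3-prime = from-yes (prime? 3)

2-prime : Prime 2
2-prime = from-yes (prime? 2)

-- Divisibility by 3 gives `k = 3k′` and `a + b = 3c`, so `(ab)² = 12c² + k′²`. Then `(ab - k′)/2`
-- and `(ab + k′)/2` have sum `ab` and product `3c²`, and `sum` with `w = c` reads `a(a + b) = 3ac`.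
-- The halves are integers since `e = ab - k′` satisfies `e² = 12c² - 2k′e`.
𝒯-Quad : (v : 𝒯) → ∃[ X ] ∃[ Y ] ∃[ w ] Quad X Y (𝒯.a v) w × 𝒯.a v + 𝒯.b v ≡ 3 * w
𝒯-Quad (mk𝒯 a b a>0 a<b (k , square)) = main
  where
  open ≡-Reasoning

  3∣k : 3 ∣ k
  3∣k = prime∣square k 3-prime (∣m+n∣m⇒∣n
    (subst (3 ∣_) (trans square (l₁ (12 * (a + b) ^ 2) k)) (divides (3 * a ^ 2 * b ^ 2) (l₂ (a ^ 2) (b ^ 2))))
    (divides (4 * (a + b) ^ 2) (l₃ ((a + b) ^ 2))))
    where
    l₁ : ∀ z k → z + k * (k * 1) ≡ z + k * k
    l₁ = solve-∀
    l₂ : ∀ x y → 9 * x * y ≡ 3 * x * y * 3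
    l₂ = solve-∀
    l₃ : ∀ x → 12 * x ≡ 4 * x * 3
    l₃ = solve-∀

  k′ : ℕ
  k′ = quotient 3∣k

  square′ : 3 * (a * b * (a * b)) ≡ 4 * ((a + b) * (a + b)) + 3 * (k′ * k′)
  square′ = *-cancelˡ-≡ _ _ 3 (begin
    3 * (3 * (a * b * (a * b)))                          ≡⟨ l₁ a b ⟩
    9 * a ^ 2 * b ^ 2                                    ≡⟨ square ⟩
    12 * (a + b) ^ 2 + k ^ 2                             ≡⟨ cong (λ z → 12 * (a + b) ^ 2 + z ^ 2) (_∣_.equality 3∣k) ⟩
    12 * (a + b) ^ 2 + (k′ * 3) ^ 2                      ≡⟨ l₂ (a + b) k′ ⟩
    3 * (4 * ((a + b) * (a + b)) + 3 * (k′ * k′))        ∎)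
    where
    l₁ : ∀ a b → 3 * (3 * (a * b * (a * b))) ≡ 9 * (a * (a * 1)) * (b * (b * 1))
    l₁ = solve-∀
    l₂ : ∀ x k → 12 * (x * (x * 1)) + (k * 3) * ((k * 3) * 1) ≡ 3 * (4 * (x * x) + 3 * (k * k))
    l₂ = solve-∀

  3∣a+b : 3 ∣ a + b
  3∣a+b = prime∣c*square 4 (a + b) 3-prime (from-no (3 ∣? 4))
    (∣m+n∣m⇒∣n {m = 3 * (k′ * k′)} (subst (3 ∣_) (trans square′ (+-comm (4 * ((a + b) * (a + b))) _)) (m∣m*n (a * b * (a * b)))) (m∣m*n (k′ * k′)))

  c : ℕ
  c = quotient 3∣a+b

  a+b≡3c : a + b ≡ 3 * c
  a+b≡3c = trans (_∣_.equality 3∣a+b) (*-comm c 3)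

  square″ : a * b * (a * b) ≡ 12 * (c * c) + k′ * k′
  square″ = *-cancelˡ-≡ _ _ 3 (trans square′ (trans (cong (λ z → 4 * (z * z) + 3 * (k′ * k′)) a+b≡3c) (l c k′)))
    where
    l : ∀ c k → 4 * (3 * c * (3 * c)) + 3 * (k * k) ≡ 3 * (12 * (c * c) + k * k)
    l = solve-∀

  c>0 : 0 < c
  c>0 = n≢0⇒n>0 λ { c≡0 → <⇒≢ (≤-trans a>0 (m≤m+n a b)) (sym (trans a+b≡3c (cong (3 *_) c≡0))) }

  k′≤ab : k′ ≤ a * b
  k′≤ab = ≮⇒≥ λ ab<k′ → <⇒≱ (*-mono-< ab<k′ ab<k′) (subst (k′ * k′ ≤_) (sym square″) (m≤n+m _ _))

  e : ℕ
  e = a * b ∸ k′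

  k′+e : k′ + e ≡ a * b
  k′+e = m+[n∸m]≡n k′≤ab

  e-eq : 2 * (k′ * e) + e * e ≡ 12 * (c * c)
  e-eq = +-cancelʳ-≡ (k′ * k′) _ _ (trans (l k′ e) (trans (cong (λ z → z * z) k′+e) square″))
    where
    l : ∀ k e → 2 * (k * e) + e * e + k * k ≡ (k + e) * (k + e)
    l = solve-∀

  2∣e : 2 ∣ e
  2∣e = prime∣square e 2-prime (∣m+n∣m⇒∣n (subst (2 ∣_) (sym e-eq) (divides (6 * (c * c)) (l (c * c)))) (m∣m*n (k′ * e)))
    where
    l : ∀ x → 12 * x ≡ 6 * x * 2
    l = solve-∀

  X : ℕ
  X = quotient 2∣e

  X-eq : X * (X + k′) ≡ 3 * (c * c)
  X-eq = *-cancelˡ-≡ _ _ 4 (begin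
    4 * (X * (X + k′))                         ≡⟨ l X k′ ⟩
    2 * (k′ * (X * 2)) + (X * 2) * (X * 2)     ≡⟨ cong (λ z → 2 * (k′ * z) + z * z) (sym (_∣_.equality 2∣e)) ⟩
    2 * (k′ * e) + e * e                       ≡⟨ e-eq ⟩
    12 * (c * c)                               ≡⟨ r (c * c) ⟩
    4 * (3 * (c * c))                          ∎)
    where
    l : ∀ X k → 4 * (X * (X + k)) ≡ 2 * (k * (X * 2)) + (X * 2) * (X * 2)
    l = solve-∀
    r : ∀ x → 12 * x ≡ 4 * (3 * x)
    r = solve-∀

  X>0 : 0 < X
  X>0 = n≢0⇒n>0 λ X≡0 → <⇒≢ (*-pos {3} (s≤s z≤n) (*-pos c>0 c>0)) (trans (cong (λ z → z * (z + k′)) (sym X≡0)) X-eq)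

  main : ∃[ X ] ∃[ Y ] ∃[ w ] Quad X Y a w × a + b ≡ 3 * w
  main = X , X + k′ , c , record
    { X>0 = X>0 ; Y>0 = ≤-trans X>0 (m≤m+n X k′) ; a>0 = a>0 ; w>0 = c>0 ; prod = X-eq
    ; sum = begin
        X + (X + k′) + a * a     ≡⟨ l X k′ (a * a) ⟩
        k′ + X * 2 + a * a       ≡⟨ cong (λ z → k′ + z + a * a) (sym (_∣_.equality 2∣e)) ⟩
        k′ + e + a * a           ≡⟨ cong (_+ a * a) k′+e ⟩
        a * b + a * a            ≡⟨ m a b ⟩
        a * (a + b)              ≡⟨ cong (a *_) a+b≡3c ⟩
        a * (3 * c)              ≡⟨ r a c ⟩
        3 * (a * c)              ∎
    } , a+b≡3c
    where
    l : ∀ X k z → X + (X + k) + z ≡ k + X * 2 + z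
    l = solve-∀
    m : ∀ a b → a * b + a * a ≡ a * (a + b)
    m = solve-∀
    r : ∀ a c → a * (3 * c) ≡ 3 * (a * c)
    r = solve-∀

-- The fibres of `π`.

-- If `3 ∣ s`, the equation gives `3 ∣ u`; then every term but `3t²` is divisible by 9, so `3 ∣ t`,
-- against coprimality. This is what tells `s²` from `3t²` in a fibre.
3∤s : ∀ x → ¬ 3 ∣ 𝒮.s x
3∤s x 3∣s@(divides k refl) = contradiction (coprime (3∣s , 3∣t)) λ ()
  where
  open 𝒮 x
  3∣u : 3 ∣ u
  3∣u = prime∣c*square 2 u 3-prime (from-no (3 ∣? 2)) (∣m+n∣m⇒∣n {m = 3 * (3 * (k * k) + t * t)}
    (divides (2 * (k * 3) * t * u) (trans (l k t u) (trans equation (r (k * 3) t u)))) (m∣m*n (3 * (k * k) + t * t)))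
    where
    l : ∀ k t u → 3 * (3 * (k * k) + t * t) + 2 * (u * u) ≡ (k * 3) * ((k * 3) * 1) + 3 * (t * (t * 1)) + 2 * (u * (u * 1))
    l = solve-∀
    r : ∀ s t u → 6 * s * t * u ≡ 2 * s * t * u * 3
    r = solve-∀
  3∣t : 3 ∣ t
  3∣t with divides j u≡ ← 3∣u = prime∣square t 3-prime (∣m+n∣m⇒∣n {m = 3 * (k * k + 2 * (j * j))}
    (divides (6 * k * t * j) (*-cancelˡ-≡ _ _ 3 (trans (l k t j) (trans
      (subst (λ u → (k * 3) ^ 2 + 3 * t ^ 2 + 2 * u ^ 2 ≡ 6 * (k * 3) * t * u) u≡ equation) (r k t j)))))
    (m∣m*n (k * k + 2 * (j * j))))
    where
    l : ∀ k t j → 3 * (3 * (k * k + 2 * (j * j)) + t * t) ≡ (k * 3) * ((k * 3) * 1) + 3 * (t * (t * 1)) + 2 * ((j * 3) * ((j * 3) * 1))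
    l = solve-∀
    r : ∀ k t j → 6 * (k * 3) * t * (j * 3) ≡ 3 * (6 * k * t * j * 3)
    r = solve-∀

size : 𝒯 → ℕ
size v = 𝒯.a v + 𝒯.b v

-- A copy of π that does not unfold: conversion checking between values of π
-- would compare their proof components by normalisation, which is infeasible.
abstract
  Π : 𝒮 → 𝒯
  Π = π

  Π≡π : ∀ x → Π x ≡ π x
  Π≡π x = refl

Π-cong : ∀ x y → 𝒮.s x ≡ 𝒮.s y → 𝒮.t x ≡ 𝒮.t y → Π x ≡ Π y
Π-cong x y p q = trans (Π≡π x) (trans (π-cong x y p q) (sym (Π≡π y)))

size-Π : ∀ x → size (Π x) ≡ 6 * (𝒮.s x * 𝒮.t x)
size-Π x = begin
  size (Π x)          ≡⟨ cong size (Π≡π x) ⟩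
  (m ∸ d) + (m + d)   ≡⟨ l (m ∸ d) m d ⟩
  (m ∸ d) + d + m     ≡⟨ cong (_+ m) (m∸n+n≡m (<⇒≤ (√disc<3st x))) ⟩
  m + m               ≡⟨ r s t ⟩
  6 * (s * t)         ∎
  where
  open 𝒮 x
  open ≡-Reasoning
  m d : ℕ
  m = 3 * s * t
  d = √disc s t
  l : ∀ e m d → e + (m + d) ≡ e + d + m
  l = solve-∀
  r : ∀ s t → 3 * s * t + 3 * s * t ≡ 6 * (s * t)
  r = solve-∀

module _ (x y : 𝒮) (Πx≡Πy : Π x ≡ Π y) where
  private
    πx≡πy : π x ≡ π y
    πx≡πy = trans (sym (Π≡π x)) (trans Πx≡Πy (Π≡π y))

    module x = 𝒮 x
    module y = 𝒮 y

    st : x.s * x.t ≡ y.s * y.t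
    st = *-cancelˡ-≡ _ _ 6 (trans (sym (size-Π x)) (trans (cong size Πx≡Πy) (size-Π y)))

    3st : 3 * x.s * x.t ≡ 3 * y.s * y.t
    3st = trans (*-assoc 3 x.s x.t) (trans (cong (3 *_) st) (sym (*-assoc 3 y.s y.t)))

    √ : √disc x.s x.t ≡ √disc y.s y.t
    √ = +-cancelˡ-≡ (3 * x.s * x.t) _ _ (trans (cong 𝒯.b πx≡πy) (cong (_+ √disc y.s y.t) (sym 3st)))

    norm : x.s ^ 2 + 3 * x.t ^ 2 ≡ y.s ^ 2 + 3 * y.t ^ 2
    norm = *-cancelˡ-≡ _ _ 2 (+-cancelˡ-≡ (√disc x.s x.t ^ 2) _ _ (begin
      √disc x.s x.t ^ 2 + 2 * (x.s ^ 2 + 3 * x.t ^ 2)  ≡⟨ √disc-exact x ⟩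
      9 * x.s ^ 2 * x.t ^ 2                            ≡⟨ l x.s x.t ⟩
      9 * (x.s * x.t) ^ 2                              ≡⟨ cong (λ z → 9 * z ^ 2) st ⟩
      9 * (y.s * y.t) ^ 2                              ≡⟨ sym (l y.s y.t) ⟩
      9 * y.s ^ 2 * y.t ^ 2                            ≡⟨ sym (√disc-exact y) ⟩
      √disc y.s y.t ^ 2 + 2 * (y.s ^ 2 + 3 * y.t ^ 2)  ≡⟨ cong (λ d → d ^ 2 + 2 * (y.s ^ 2 + 3 * y.t ^ 2)) (sym √) ⟩
      √disc x.s x.t ^ 2 + 2 * (y.s ^ 2 + 3 * y.t ^ 2)  ∎))
      where
      open ≡-Reasoning
      l : ∀ s t → 9 * (s * (s * 1)) * (t * (t * 1)) ≡ 9 * ((s * t) * ((s * t) * 1))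
      l = solve-∀

    product : x.s ^ 2 * (3 * x.t ^ 2) ≡ y.s ^ 2 * (3 * y.t ^ 2)
    product = trans (l x.s x.t) (trans (cong (λ z → 3 * z ^ 2) st) (sym (l y.s y.t)))
      where
      l : ∀ s t → (s * (s * 1)) * (3 * (t * (t * 1))) ≡ 3 * ((s * t) * ((s * t) * 1))
      l = solve-∀

  -- The image determines the sum and the product of `s²` and `3t²`, hence the two numbers up to
  -- order; the wrong order would give `3 ∣ s`.
  Π-reflects-s : x.s ≡ y.s
  Π-reflects-s with vieta-unique norm product
  ... | inj₁ e = ^2-injective _ _ e
  ... | inj₂ e = contradiction (prime∣square x.s 3-prime
    (subst (3 ∣_) (trans (sym e) (cong (x.s *_) (*-identityʳ x.s))) (m∣m*n (y.t ^ 2)))) (3∤s x)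

  Π-reflects-t : x.t ≡ y.t
  Π-reflects-t = *-cancelˡ-≡ _ _ x.s {{>-nonZero x.s>0}} (trans st (cong (_* y.t) (sym Π-reflects-s)))

  -- Once `s` and `t` agree, `u` is a root of a fixed quadratic whose roots `φ₃` exchanges.
  Π-reflects-u : x.u ≡ y.u ⊎ x.u ≡ 𝒮.u (φ₃ y)
  Π-reflects-u = vieta-unique
    (trans X.x+jump (trans 3st (sym Y.x+jump)))
    (*-cancelˡ-≡ _ _ 2 (trans (sym (*-assoc 2 x.u X.jump))
      (trans (sym X.product) (trans norm (trans Y.product (*-assoc 2 y.u Y.jump))))))
    where
    module X = Vieta-u x
    module Y = Vieta-u y

-- With `u + u′ = 3st` and `2uu′ = s² + 3t²`, the discriminant `9s²t² - 2(s² + 3t²)` is `(u′ - u)²`.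
π-coordinates : ∀ x → 𝒮.u x ≤ 𝒮.u (φ₃ x) → 𝒯.a (π x) ≡ 2 * 𝒮.u x × 𝒯.b (π x) ≡ 2 * 𝒮.u (φ₃ x)
π-coordinates x u≤jump
  with δ , u+δ ← m≤n⇒∃[o]m+o≡n u≤jump = a≡ , b≡
  where
  open 𝒮 x
  open Vieta-u x using (jump; x+jump; product)
  open ≡-Reasoning
  sq : (u + (u + δ)) ^ 2 ≡ 9 * s ^ 2 * t ^ 2
  sq = trans (cong (λ z → (u + z) ^ 2) u+δ) (trans (cong (_^ 2) x+jump) (l s t))
    where
    l : ∀ s t → (3 * s * t) * ((3 * s * t) * 1) ≡ 9 * (s * (s * 1)) * (t * (t * 1))
    l = solve-∀
  disc : √disc s t ≡ δ
  disc = ^2-injective _ _ (+-cancelʳ-≡ (2 * (s ^ 2 + 3 * t ^ 2)) _ _ (begin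
    √disc s t ^ 2 + 2 * (s ^ 2 + 3 * t ^ 2)   ≡⟨ √disc-exact x ⟩
    9 * s ^ 2 * t ^ 2                         ≡⟨ sym sq ⟩
    (u + (u + δ)) ^ 2                         ≡⟨ l u δ ⟩
    δ ^ 2 + 2 * (2 * u * (u + δ))             ≡⟨ cong (λ z → δ ^ 2 + 2 * (2 * u * z)) u+δ ⟩
    δ ^ 2 + 2 * (2 * u * jump)                ≡⟨ cong (λ z → δ ^ 2 + 2 * z) (sym product) ⟩
    δ ^ 2 + 2 * (s ^ 2 + 3 * t ^ 2)           ∎))
    where
    l : ∀ u δ → (u + (u + δ)) * ((u + (u + δ)) * 1) ≡ δ * (δ * 1) + 2 * (2 * u * (u + δ))
    l = solve-∀
  3st : 2 * u + δ ≡ 3 * s * t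
  3st = trans (l u δ) (trans (cong (u +_) u+δ) x+jump)
    where
    l : ∀ u δ → 2 * u + δ ≡ u + (u + δ)
    l = solve-∀
  a≡ : 3 * s * t ∸ √disc s t ≡ 2 * u
  a≡ = trans (cong₂ _∸_ (sym 3st) disc) (m+n∸n≡m (2 * u) δ)
  b≡ : 3 * s * t + √disc s t ≡ 2 * jump
  b≡ = trans (cong₂ _+_ (sym 3st) disc) (trans (l u δ) (cong (2 *_) u+δ))
    where
    l : ∀ u δ → 2 * u + δ + δ ≡ 2 * (u + δ)
    l = solve-∀

-- `low` is the point `(s,t,q)` with `a = 2q`, and `φ₃ low` is `(s,t,r)` with `b = 2r`.
record Fibre (v : 𝒯) : Set where
  field
    low   : 𝒮
    reach : Reach low
    Π-low : Π low ≡ v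
    a≡    : 𝒯.a v ≡ 2 * 𝒮.u low
    b≡    : 𝒯.b v ≡ 2 * 𝒮.u (φ₃ low)

  u<u′ : 𝒮.u low < 𝒮.u (φ₃ low)
  u<u′ = *-cancelˡ-< 2 _ _ (subst (_< 2 * 𝒮.u (φ₃ low)) a≡ (subst (𝒯.a v <_) b≡ (𝒯.a<b v)))

abstract
  -- Surjectivity of `π`. The descent yields a point with `a = 2u`, and `a < b` makes it the lower
  -- one. Being abstract, the descent is not evaluated in later conversion checks.
  fibre : ∀ v → Fibre v
  fibre v = from (descend Q (<-wellFounded _))
    where
    open 𝒯 v
    w : ℕ
    w = proj₁ (proj₂ (proj₂ (𝒯-Quad v)))
    Q : Quad (proj₁ (𝒯-Quad v)) (proj₁ (proj₂ (𝒯-Quad v))) a w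
    Q = proj₁ (proj₂ (proj₂ (proj₂ (𝒯-Quad v))))
    a+b : a + b ≡ 3 * w
    a+b = proj₂ (proj₂ (proj₂ (proj₂ (𝒯-Quad v))))
    from : Lift (proj₁ (𝒯-Quad v)) a w → Fibre v
    from L = record
      { low = point ; reach = reach
      ; Π-low = trans (Π≡π point) (𝒯-≡ (trans (proj₁ coords) (sym a≡2u)) (trans (proj₂ coords) (sym b≡)))
      ; a≡ = a≡2u ; b≡ = b≡ }
      where
      open Lift L
      open 𝒮 point using (s; t; u)
      open Vieta-u point using (jump; x+jump)
      open ≡-Reasoning
      b≡ : b ≡ 2 * jump
      b≡ = +-cancelˡ-≡ a _ _ (begin
        a + b                   ≡⟨ a+b ⟩
        3 * w                   ≡⟨ cong (3 *_) w≡2st ⟩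
        3 * (2 * (s * t))       ≡⟨ l s t ⟩
        2 * (3 * s * t)         ≡⟨ cong (2 *_) (sym x+jump) ⟩
        2 * (u + jump)          ≡⟨ *-distribˡ-+ 2 u jump ⟩
        2 * u + 2 * jump        ≡⟨ cong (_+ 2 * jump) (sym a≡2u) ⟩
        a + 2 * jump            ∎)
        where
        l : ∀ s t → 3 * (2 * (s * t)) ≡ 2 * (3 * s * t)
        l = solve-∀
      u<jump : u < jump
      u<jump = *-cancelˡ-< 2 _ _ (subst (_< 2 * jump) a≡2u (subst (a <_) b≡ a<b))
      coords : 𝒯.a (π point) ≡ 2 * u × 𝒯.b (π point) ≡ 2 * jump
      coords = π-coordinates point (<⇒≤ u<jump)

-- How the involutions change `s` and `t`.

-- For `A = 1 + α`, `B = 1 + β` the right side exceeds the left by `2α + β + 3αβ`, which must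
-- vanish.
unit-squares : ∀ {A B} → 0 < A → 0 < B → A + 2 * B ≡ 3 * (A * B) → A ≡ 1
unit-squares {suc α} {suc β} _ _ eq = cong suc (m+n≡0⇒m≡0 α (m+n≡0⇒m≡0 (α + α)
  (+-cancelˡ-≡ (suc α + 2 * suc β) _ _ (trans (sym (trans eq (l α β))) (sym (+-identityʳ _))))))
  where
  l : ∀ α β → 3 * ((1 + α) * (1 + β)) ≡ (1 + α) + 2 * (1 + β) + (α + α + (β + 3 * (α * β)))
  l = solve-∀

module _ (x : 𝒮) where
  open 𝒮 x
  private
    module S = Vieta-s x
    module T = Vieta-t x
    module U = Vieta-u x

  φ₁-product : s * 𝒮.s (φ₁ x) ≡ 3 * (t * t) + 2 * (u * u)
  φ₁-product = trans (cong (_* S.jump) (sym (*-identityˡ s))) (trans (sym S.product) (l t u))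
    where
    l : ∀ t u → 3 * (t * (t * 1)) + 2 * (u * (u * 1)) ≡ 3 * (t * t) + 2 * (u * u)
    l = solve-∀

  φ₂-product : 3 * (t * 𝒮.t (φ₂ x)) ≡ s * s + 2 * (u * u)
  φ₂-product = trans (sym (*-assoc 3 t T.jump)) (trans (sym T.product) (l s u))
    where
    l : ∀ s u → s * (s * 1) + 2 * (u * (u * 1)) ≡ s * s + 2 * (u * u)
    l = solve-∀

  φ₃-product : 2 * (u * 𝒮.u (φ₃ x)) ≡ s * s + 3 * (t * t)
  φ₃-product = trans (sym (*-assoc 2 u U.jump)) (trans (sym U.product) (l s t))
    where
    l : ∀ s t → s * (s * 1) + 3 * (t * (t * 1)) ≡ s * s + 3 * (t * t)
    l = solve-∀

  -- A fixed `s` would be `3tu`, so that `9t²u² = 3t² + 2u² ≤ 5t²u²`.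
  φ₁-moves-s : 𝒮.s (φ₁ x) ≢ s
  φ₁-moves-s e = <-irrefl refl (begin-strict
    3 * (t * t) + 2 * (u * u)                      ≡⟨ cong₂ (λ y z → 3 * y + 2 * z) (sym (*-identityʳ (t * t))) (sym (*-identityˡ (u * u))) ⟩
    3 * (t * t * 1) + 2 * (1 * (u * u))            ≤⟨ +-mono-≤ (*-monoʳ-≤ 3 (*-monoʳ-≤ (t * t) (*-pos u>0 u>0)))
                                                             (*-monoʳ-≤ 2 (*-monoˡ-≤ (u * u) (*-pos t>0 t>0))) ⟩
    3 * p + 2 * p                                  <⟨ m<m+n _ (*-pos {4} (s≤s z≤n) (*-pos (*-pos t>0 t>0) (*-pos u>0 u>0))) ⟩
    3 * p + 2 * p + 4 * p                          ≡⟨ l t u ⟩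
    3 * t * u * (3 * t * u)                        ≡⟨ cong₂ _*_ (sym s≡3tu) (sym s≡3tu) ⟩
    s * s                                          ≡⟨ cong (s *_) (sym e) ⟩
    s * 𝒮.s (φ₁ x)                                 ≡⟨ φ₁-product ⟩
    3 * (t * t) + 2 * (u * u)                      ∎)
    where
    open ≤-Reasoning
    p : ℕ
    p = t * t * (u * u)
    l : ∀ t u → 3 * (t * t * (u * u)) + 2 * (t * t * (u * u)) + 4 * (t * t * (u * u)) ≡ 3 * t * u * (3 * t * u)
    l = solve-∀
    s≡3tu : s ≡ 3 * t * u
    s≡3tu = *-cancelˡ-≡ _ _ 2 (trans (cong (s +_) (trans (+-identityʳ s) (sym e))) (trans S.x+jump (r t u)))
      where
      r : ∀ t u → 6 * t * u ≡ 2 * (3 * t * u)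
      r = solve-∀

  -- A fixed `t` is `su`, and the product of the roots gives `s² + 2u² = 3s²u²`, whence `s = u = 1`.
  -- This loop is why the root has one neighbour fewer.
  φ₂-fixes-t : 𝒮.t (φ₂ x) ≡ t → s ≡ 1 × t ≡ 1
  φ₂-fixes-t e = s≡1 , trans t≡su (cong₂ _*_ s≡1 u≡1)
    where
    t≡su : t ≡ s * u
    t≡su = *-cancelˡ-≡ _ _ 2 (trans (cong (t +_) (trans (+-identityʳ t) (sym e))) (trans T.x+jump (*-assoc 2 s u)))
    eq : s * s + 2 * (u * u) ≡ 3 * (s * s * (u * u))
    eq = trans (sym φ₂-product) (trans (cong₂ (λ y z → 3 * (y * z)) t≡su (trans e t≡su)) (l s u))
      where
      l : ∀ s u → 3 * (s * u * (s * u)) ≡ 3 * (s * s * (u * u))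
      l = solve-∀
    s²≡1 : s * s ≡ 1
    s²≡1 = unit-squares (*-pos s>0 s>0) (*-pos u>0 u>0) eq
    s≡1 : s ≡ 1
    s≡1 = m*n≡1⇒m≡1 s s s²≡1
    u≡1 : u ≡ 1
    u≡1 = m*n≡1⇒m≡1 u u (+-cancelˡ-≡ (2 * (u * u)) _ _
      (sym (trans (+-comm (2 * (u * u)) 1) (trans (subst (λ z → z + 2 * (u * u) ≡ 3 * (z * (u * u))) s²≡1 eq) (l u)))))
      where
      l : ∀ u → 3 * (1 * (u * u)) ≡ 2 * (u * u) + u * u
      l = solve-∀

  -- The products of roots would give `3t² + 2u² ≤ s²` and `s² + 2u² ≤ 3t²`, whose sum is `4u² ≤ 0`.
  not-both-down : 𝒮.s (φ₁ x) ≤ s → ¬ 𝒮.t (φ₂ x) ≤ t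
  not-both-down s′≤s t′≤t = <-irrefl refl (begin-strict
    s * s                                    <⟨ m<m+n _ (*-pos {4} (s≤s z≤n) (*-pos u>0 u>0)) ⟩
    s * s + 4 * (u * u)                      ≡⟨ l (s * s) (u * u) ⟩
    s * s + 2 * (u * u) + 2 * (u * u)        ≡⟨ cong (_+ 2 * (u * u)) (sym φ₂-product) ⟩
    3 * (t * 𝒮.t (φ₂ x)) + 2 * (u * u)       ≤⟨ +-monoˡ-≤ (2 * (u * u)) (*-monoʳ-≤ 3 (*-monoʳ-≤ t t′≤t)) ⟩
    3 * (t * t) + 2 * (u * u)                ≡⟨ sym φ₁-product ⟩
    s * 𝒮.s (φ₁ x)                           ≤⟨ *-monoʳ-≤ s s′≤s ⟩
    s * s                                    ∎)
    where
    open ≤-Reasoning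
    l : ∀ x y → x + 4 * y ≡ x + 2 * y + 2 * y
    l = solve-∀

module _ (x : 𝒮) (u<u′ : 𝒮.u x < 𝒮.u (φ₃ x)) where
  open 𝒮 x
  private
    u′ : ℕ
    u′ = 𝒮.u (φ₃ x)

    2u′² : s * s + 3 * (t * t) < 2 * (u′ * u′)
    2u′² = subst (_< 2 * (u′ * u′)) (φ₃-product x)
      (*-monoʳ-< 2 (*-monoˡ-< u′ {{>-nonZero (𝒮.u>0 (φ₃ x))}} u<u′))

    u²<u′² : u * u < u′ * u′
    u²<u′² = *-mono-< u<u′ u<u′

  -- From `u < u′` follows `2u′² > 2uu′ = s² + 3t²`, so the product `3t² + 2u′²` of the two roots
  -- exceeds `s²`. The same bound serves `φ₂φ₃-up`.
  φ₁φ₃-up : s < 𝒮.s (φ₁ (φ₃ x))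
  φ₁φ₃-up = *-cancelˡ-< s _ _ (begin-strict
    s * s                            ≤⟨ m≤m+n (s * s) (3 * (t * t)) ⟩
    s * s + 3 * (t * t)              <⟨ 2u′² ⟩
    2 * (u′ * u′)                    ≤⟨ m≤n+m (2 * (u′ * u′)) (3 * (t * t)) ⟩
    3 * (t * t) + 2 * (u′ * u′)      ≡⟨ sym (φ₁-product (φ₃ x)) ⟩
    s * 𝒮.s (φ₁ (φ₃ x))              ∎)
    where open ≤-Reasoning

  φ₂φ₃-up : t < 𝒮.t (φ₂ (φ₃ x))
  φ₂φ₃-up = *-cancelˡ-< t _ _ (*-cancelˡ-< 3 _ _ (begin-strict
    3 * (t * t)                      ≤⟨ m≤n+m (3 * (t * t)) (s * s) ⟩
    s * s + 3 * (t * t)              <⟨ 2u′² ⟩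
    2 * (u′ * u′)                    ≤⟨ m≤n+m (2 * (u′ * u′)) (s * s) ⟩
    s * s + 2 * (u′ * u′)            ≡⟨ sym (φ₂-product (φ₃ x)) ⟩
    3 * (t * 𝒮.t (φ₂ (φ₃ x)))        ∎))
    where open ≤-Reasoning

  φ₁≢φ₁φ₃ : 𝒮.s (φ₁ x) ≢ 𝒮.s (φ₁ (φ₃ x))
  φ₁≢φ₁φ₃ e = <⇒≢ u²<u′² (*-cancelˡ-≡ _ _ 2 (+-cancelˡ-≡ (3 * (t * t)) _ _
    (trans (sym (φ₁-product x)) (trans (cong (s *_) e) (φ₁-product (φ₃ x))))))

  φ₂≢φ₂φ₃ : 𝒮.t (φ₂ x) ≢ 𝒮.t (φ₂ (φ₃ x))
  φ₂≢φ₂φ₃ e = <⇒≢ u²<u′² (*-cancelˡ-≡ _ _ 2 (+-cancelˡ-≡ (s * s) _ _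
    (trans (sym (φ₂-product x)) (trans (cong (λ z → 3 * (t * z)) e) (φ₂-product (φ₃ x))))))

-- The four maps on vertices.

module _ {x y : 𝒮} (s≡ : 𝒮.s x ≡ 𝒮.s y) (t≡ : 𝒮.t x ≡ 𝒮.t y) (u≡ : 𝒮.u x ≡ 𝒮.u y) where

  φ-cong-s : ∀ i → 𝒮.s (φ i x) ≡ 𝒮.s (φ i y)
  φ-cong-s zero       = cong₂ _∸_ (cong₂ (λ t u → 6 * t * u) t≡ u≡) s≡
  φ-cong-s (suc zero) = s≡

  φ-cong-t : ∀ i → 𝒮.t (φ i x) ≡ 𝒮.t (φ i y)
  φ-cong-t zero       = t≡
  φ-cong-t (suc zero) = cong₂ _∸_ (cong₂ (λ s u → 2 * s * u) s≡ u≡) t≡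

  φ-cong : ∀ i → Π (φ i x) ≡ Π (φ i y)
  φ-cong i = Π-cong (φ i x) (φ i y) (φ-cong-s i) (φ-cong-t i)

low high : 𝒯 → 𝒮
low v = Fibre.low (fibre v)
high v = φ₃ (low v)

Π-low : ∀ v → Π (low v) ≡ v
Π-low v = Fibre.Π-low (fibre v)

Π-high : ∀ v → Π (high v) ≡ v
Π-high v = trans (Π-cong (high v) (low v) refl refl) (Π-low v)

low<high : ∀ v → 𝒮.u (low v) < 𝒮.u (high v)
low<high v = Fibre.u<u′ (fibre v)

varphi psi : Fin 2 → 𝒯 → 𝒯
varphi i v = Π (φ i (low v))
psi    i v = Π (φ i (high v))

same-fibre : ∀ {v} x y → Π x ≡ v → Π y ≡ v → 𝒮.u x ≡ 𝒮.u y → ∀ i → Π (φ i x) ≡ Π (φ i y)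
same-fibre x y Πx Πy u = φ-cong {x} {y} (Π-reflects-s x y eq) (Π-reflects-t x y eq) u
  where
  eq : Π x ≡ Π y
  eq = trans Πx (sym Πy)

varphi-map : ∀ i → varphi i IsTheMap VarphiGraph i
varphi-map i v w = mk⇔ to from
  where
  to : varphi i v ≡ w → VarphiGraph i v w
  to e = low v , Fibre.a≡ (fibre v) , trans (sym (Π≡π (low v))) (Π-low v) , trans (sym (Π≡π (φ i (low v)))) e
  from : VarphiGraph i v w → varphi i v ≡ w
  from (x , a≡ , πx , e) = trans
    (same-fibre (low v) x (Π-low v) (trans (Π≡π x) πx)
      (*-cancelˡ-≡ _ _ 2 (trans (sym (Fibre.a≡ (fibre v))) a≡)) i)
    (trans (Π≡π (φ i x)) e)

psi-map : ∀ i → psi i IsTheMap PsiGraph i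
psi-map i v w = mk⇔ to from
  where
  to : psi i v ≡ w → PsiGraph i v w
  to e = high v , Fibre.b≡ (fibre v) , trans (sym (Π≡π (high v))) (Π-high v) , trans (sym (Π≡π (φ i (high v)))) e
  from : PsiGraph i v w → psi i v ≡ w
  from (x , b≡ , πx , e) = trans
    (same-fibre (high v) x (Π-high v) (trans (Π≡π x) πx)
      (*-cancelˡ-≡ _ _ 2 (trans (sym (Fibre.b≡ (fibre v))) b≡)) i)
    (trans (Π≡π (φ i x)) e)

varphi-edge : ∀ i v → v ≢ varphi i v → Edge v (varphi i v)
varphi-edge i v v≢ = v≢ , low v , i , trans (sym (Π≡π (low v))) (Π-low v) , sym (Π≡π (φ i (low v)))

psi-edge : ∀ i v → v ≢ psi i v → Edge v (psi i v)
psi-edge i v v≢ = v≢ , high v , i , trans (sym (Π≡π (high v))) (Π-high v) , sym (Π≡π (φ i (high v)))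

-- A point over `v` has the coordinates of `low v` or of `high v`, and these determine the image.
φ-image : ∀ {v} x i → Π x ≡ v → varphi i v ≡ Π (φ i x) ⊎ psi i v ≡ Π (φ i x)
φ-image {v} x i Πx = Sum.map
  (λ u≡ → same-fibre (low v) x (Π-low v) Πx (sym u≡) i)
  (λ u≡ → same-fibre (high v) x (Π-high v) Πx (sym u≡) i)
  (Π-reflects-u x (low v) (trans Πx (sym (Π-low v))))

-- Generation from the root and connectedness.

Π-one : Π one ≡ root
Π-one = trans (Π≡π one) (𝒯-≡ refl refl)

-- Each `move` becomes `varphi i` or `psi i` according to the point of the fibre it starts from; a
-- `flip` stays in the fibre.
reach-Generated : ∀ {x} → Reach x → Generated varphi psi (Π x)
reach-Generated {x} (base s≡1 t≡1) =
  subst (Generated varphi psi) (sym (trans (Π-cong x one s≡1 t≡1) Π-one)) start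
reach-Generated (move i {x} r) =
  [ (λ e → subst (Generated varphi psi) e (step-varphi i (reach-Generated r)))
  , (λ e → subst (Generated varphi psi) e (step-psi i (reach-Generated r)))
  ]′ (φ-image x i refl)
reach-Generated (flip {x} r) =
  subst (Generated varphi psi) (sym (Π-cong (φ₃ x) x refl refl)) (reach-Generated r)

generated : ∀ v → Generated varphi psi v
generated v = subst (Generated varphi psi) (Π-low v) (reach-Generated (Fibre.reach (fibre v)))

_≟𝒯_ : (v w : 𝒯) → Dec (v ≡ w)
v ≟𝒯 w with 𝒯.a v ≟ 𝒯.a w | 𝒯.b v ≟ 𝒯.b w
... | yes p | yes q = yes (𝒯-≡ p q)
... | no ¬p | _     = no (¬p ∘ cong 𝒯.a)
... | _     | no ¬q = no (¬q ∘ cong 𝒯.b)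

-- Case distinctions on vertices go through auxiliary functions, since a
-- with-abstraction would normalise φ₁, φ₂ and φ₃ including their proof fields.
extend : ∀ {u v w} → Star Edge u v → (v ≢ w → Edge v w) → Star Edge u w
extend {u} {v} {w} p e = by-cases (v ≟𝒯 w)
  where
  by-cases : Dec (v ≡ w) → Star Edge u w
  by-cases (yes v≡w) = subst (Star Edge u) v≡w p
  by-cases (no v≢w)  = p ◅◅ (e v≢w ◅ ε)

-- A map that fixes the current vertex, as `varphi (suc zero)` does at the root, adds no edge to the
-- path.
path-to : ∀ {v} → Generated varphi psi v → Star Edge root v
path-to start               = ε
path-to (step-varphi i {v} g) = extend (path-to g) (varphi-edge i v)
path-to (step-psi i {v} g)    = extend (path-to g) (psi-edge i v)

connected : Connected 𝒯-graph
connected v w = reverse (λ {v} {w} → SimpleGraph.adj-sym 𝒯-graph {v} {w}) (path-to (generated v)) ◅◅ path-to (generated w)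

-- Growth of `a + b` along edges, and absence of cycles.

size-low : ∀ v → size v ≡ 6 * (𝒮.s (low v) * 𝒮.t (low v))
size-low v = trans (cong size (sym (Π-low v))) (size-Π (low v))

-- The size is `6st`, so for equal `t` comparing sizes compares `s`.
s-≤ : ∀ v x → 𝒮.t x ≡ 𝒮.t (low v) → size (Π x) ≤ size v → 𝒮.s x ≤ 𝒮.s (low v)
s-≤ v x t≡ le = *-cancelʳ-≤ _ _ (𝒮.t (low v)) {{>-nonZero (𝒮.t>0 (low v))}} (*-cancelˡ-≤ 6
  (subst (λ t → 6 * (𝒮.s x * t) ≤ 6 * (𝒮.s (low v) * 𝒮.t (low v))) t≡ (begin
    6 * (𝒮.s x * 𝒮.t x)                ≡⟨ sym (size-Π x) ⟩
    size (Π x)                         ≤⟨ le ⟩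
    size v                             ≡⟨ size-low v ⟩
    6 * (𝒮.s (low v) * 𝒮.t (low v))    ∎)))
  where open ≤-Reasoning

t-≤ : ∀ v x → 𝒮.s x ≡ 𝒮.s (low v) → size (Π x) ≤ size v → 𝒮.t x ≤ 𝒮.t (low v)
t-≤ v x s≡ le = *-cancelˡ-≤ (𝒮.s (low v)) {{>-nonZero (𝒮.s>0 (low v))}} (*-cancelˡ-≤ 6
  (subst (λ s → 6 * (s * 𝒮.t x) ≤ 6 * (𝒮.s (low v) * 𝒮.t (low v))) s≡ (begin
    6 * (𝒮.s x * 𝒮.t x)                ≡⟨ sym (size-Π x) ⟩
    size (Π x)                         ≤⟨ le ⟩
    size v                             ≡⟨ size-low v ⟩
    6 * (𝒮.s (low v) * 𝒮.t (low v))    ∎)))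
  where open ≤-Reasoning

psi-up : ∀ i v → size v < size (psi i v)
psi-up zero       v = ≰⇒> λ le → <⇒≱ (φ₁φ₃-up (low v) (low<high v)) (s-≤ v (φ zero (high v)) refl le)
psi-up (suc zero) v = ≰⇒> λ le → <⇒≱ (φ₂φ₃-up (low v) (low<high v)) (t-≤ v (φ (suc zero) (high v)) refl le)

edge-neighbour : ∀ {v w} → Edge v w → ∃[ i ] (varphi i v ≡ w ⊎ psi i v ≡ w)
edge-neighbour {v} {w} (_ , x , i , πx , e) =
  i , Sum.map via via (φ-image x i (trans (Π≡π x) πx))
  where
  via : ∀ {y} → y ≡ Π (φ i x) → y ≡ w
  via eq = trans eq (trans (Π≡π (φ i x)) e)

down-neighbour : ∀ {v w} → Edge v w → size w ≤ size v → ∃[ i ] varphi i v ≡ w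
down-neighbour {v} {w} e le = by-cases (edge-neighbour e)
  where
  by-cases : ∃[ i ] (varphi i v ≡ w ⊎ psi i v ≡ w) → ∃[ i ] varphi i v ≡ w
  by-cases (i , inj₁ eq) = i , eq
  by-cases (i , inj₂ eq) = contradiction (subst (λ z → size z ≤ size v) (sym eq) le) (<⇒≱ (psi-up i v))

varphi-not-both-down : ∀ v → size (varphi zero v) ≤ size v → ¬ size (varphi (suc zero) v) ≤ size v
varphi-not-both-down v le le′ = not-both-down (low v)
  (s-≤ v (φ zero (low v)) refl le) (t-≤ v (φ (suc zero) (low v)) refl le′)

down-unique : ∀ {v w w′} → Edge v w → Edge v w′ → size w ≤ size v → size w′ ≤ size v → w ≡ w′
down-unique {v} {w} {w′} e e′ le le′ = by-cases (down-neighbour e le) (down-neighbour e′ le′)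
  where
  small : ∀ {y z} → y ≡ z → size z ≤ size v → size y ≤ size v
  small eq = subst (λ z → size z ≤ size v) (sym eq)
  by-cases : ∃[ i ] varphi i v ≡ w → ∃[ i ] varphi i v ≡ w′ → w ≡ w′
  by-cases (zero     , p) (zero     , q) = trans (sym p) q
  by-cases (suc zero , p) (suc zero , q) = trans (sym p) q
  by-cases (zero     , p) (suc zero , q) = contradiction (small q le′) (varphi-not-both-down v (small p le))
  by-cases (suc zero , p) (zero     , q) = contradiction (small p le) (varphi-not-both-down v (small q le′))

argmax : ∀ {n} (f : Fin (suc n) → ℕ) → ∃[ i ] (∀ j → f j ≤ f i)
argmax {zero}  f = zero , λ { zero → ≤-refl }
argmax {suc n} f with argmax (f ∘ suc)
... | i , max with ≤-total (f zero) (f (suc i))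
...   | inj₁ le = suc i , λ { zero → le ; (suc j) → max j }
...   | inj₂ ge = zero  , λ { zero → ≤-refl ; (suc j) → ≤-trans (max j) ge }

module _ {G : SimpleGraph} (C : Cycle G) where
  open SimpleGraph G
  open Cycle C

  -- The cases are the first, the last and an interior vertex. Length at least 3 separates the two
  -- indices at both ends; inside they are `j + 2` and `j`.
  cycle-neighbours : ∀ i → ∃[ j ] ∃[ k ] j ≢ k × Adj (vertex i) (vertex j) × Adj (vertex i) (vertex k)
  cycle-neighbours zero = suc zero , fromℕ (2 + n) , (λ ()) , step zero , adj-sym close
  cycle-neighbours (suc i) with view i
  ... | ‵fromℕ    = zero , inject₁ (fromℕ (1 + n)) , (λ ()) , close , adj-sym (step (fromℕ (1 + n)))
  ... | ‵inject₁ j = suc (suc j) , inject₁ (inject₁ j) , apart , step (suc j) , adj-sym (step (inject₁ j))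
    where
    apart : suc (suc j) ≢ inject₁ (inject₁ j)
    apart e = <⇒≢ (m<n+m (toℕ j) {2} (s≤s z≤n)) (sym (trans (cong toℕ e)
      (trans (toℕ-inject₁ (inject₁ j)) (toℕ-inject₁ j))))

acyclic : ¬ Cycle 𝒯-graph
acyclic C = absurd (argmax (size ∘ vertex))
  where
  open Cycle C using (vertex; distinct)
  absurd : ¬ (∃[ i ] (∀ j → size (vertex j) ≤ size (vertex i)))
  absurd (i , max) =
    let j , k , j≢k , ej , ek = cycle-neighbours C i
    in j≢k (distinct (down-unique ej ek (max j) (max k)))

-- Infinitude.

increasing⇒injective : ∀ {A : Set} (size : A → ℕ) (f : ℕ → A) →
  (∀ n → size (f n) < size (f (suc n))) → Injective _≡_ _≡_ f
increasing⇒injective size f up {m} {n} e = by-cases (<-cmp m n)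
  where
  mono : ∀ {m n} → m <′ n → size (f m) < size (f n)
  mono {m} <′-base           = up m
  mono {m} (≤′-step {n} m<n) = <-trans (mono m<n) (up n)
  by-cases : Tri (m < n) (m ≡ n) (n < m) → m ≡ n
  by-cases (tri< m<n _ _) = contradiction (cong size e) (<⇒≢ (mono (<⇒<′ m<n)))
  by-cases (tri≈ _ m≡n _) = m≡n
  by-cases (tri> _ _ n<m) = contradiction (cong size (sym e)) (<⇒≢ (mono (<⇒<′ n<m)))

psi-iterate : ℕ → 𝒯
psi-iterate zero    = root
psi-iterate (suc n) = psi zero (psi-iterate n)

infinite : Infinite 𝒯-graph
infinite = mk↣ (increasing⇒injective size psi-iterate (psi-up zero ∘ psi-iterate))

-- Degrees.

module _ (v : 𝒯) where
  private
    x : 𝒮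
    x = low v
    lt : 𝒮.u x < 𝒮.u (φ₃ x)
    lt = low<high v

  -- The three maps without fixed vertices; `varphi (suc zero)` is treated apart because it fixes
  -- the root.
  moving : Fin 3 → 𝒯
  moving zero             = varphi zero v
  moving (suc zero)       = psi zero v
  moving (suc (suc zero)) = psi (suc zero) v

  moving≢v : ∀ i → moving i ≢ v
  moving≢v zero e = φ₁-moves-s x (Π-reflects-s (φ zero x) x (trans e (sym (Π-low v))))
  moving≢v (suc zero) e = <⇒≢ (psi-up zero v) (cong size (sym e))
  moving≢v (suc (suc zero)) e = <⇒≢ (psi-up (suc zero) v) (cong size (sym e))

  private
    y : 𝒮
    y = high v

    varphi₁≢psi₁ : varphi zero v ≢ psi zero v
    varphi₁≢psi₁ e = φ₁≢φ₁φ₃ x lt (Π-reflects-s (φ zero x) (φ zero y) e)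

    -- `φ₂` and `φ₃` keep `s` while `φ₁` changes it, so `s` separates images under `φ₁` from images
    -- under `φ₂`.
    varphi₁≢psi₂ : varphi zero v ≢ psi (suc zero) v
    varphi₁≢psi₂ e = φ₁-moves-s x (Π-reflects-s (φ zero x) (φ (suc zero) y) e)

    psi₁≢psi₂ : psi zero v ≢ psi (suc zero) v
    psi₁≢psi₂ e = φ₁-moves-s y (Π-reflects-s (φ zero y) (φ (suc zero) y) e)

  moving-injective : Injective _≡_ _≡_ moving
  moving-injective {zero}           {zero}           _ = refl
  moving-injective {zero}           {suc zero}       e = contradiction e varphi₁≢psi₁
  moving-injective {zero}           {suc (suc zero)} e = contradiction e varphi₁≢psi₂
  moving-injective {suc zero}       {zero}           e = contradiction (sym e) varphi₁≢psi₁
  moving-injective {suc zero}       {suc zero}       _ = refl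
  moving-injective {suc zero}       {suc (suc zero)} e = contradiction e psi₁≢psi₂
  moving-injective {suc (suc zero)} {zero}           e = contradiction (sym e) varphi₁≢psi₂
  moving-injective {suc (suc zero)} {suc zero}       e = contradiction (sym e) psi₁≢psi₂
  moving-injective {suc (suc zero)} {suc (suc zero)} _ = refl

  varphi₂≢moving : ∀ i → varphi (suc zero) v ≢ moving i
  varphi₂≢moving zero e = φ₁-moves-s x (sym (Π-reflects-s (φ (suc zero) x) (φ zero x) e))
  varphi₂≢moving (suc zero) e = φ₁-moves-s y (sym (Π-reflects-s (φ (suc zero) x) (φ zero y) e))
  varphi₂≢moving (suc (suc zero)) e = φ₂≢φ₂φ₃ x lt (Π-reflects-t (φ (suc zero) x) (φ (suc zero) y) e)

  moving-edge : ∀ i → Edge v (moving i)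
  moving-edge zero             = varphi-edge zero v (moving≢v zero ∘ sym)
  moving-edge (suc zero)       = psi-edge zero v (moving≢v (suc zero) ∘ sym)
  moving-edge (suc (suc zero)) = psi-edge (suc zero) v (moving≢v (suc (suc zero)) ∘ sym)

  edge-cases : ∀ {w} → Edge v w → varphi (suc zero) v ≡ w ⊎ ∃[ i ] moving i ≡ w
  edge-cases {w} e = by-cases (edge-neighbour e)
    where
    by-cases : ∃[ i ] (varphi i v ≡ w ⊎ psi i v ≡ w) → varphi (suc zero) v ≡ w ⊎ ∃[ i ] moving i ≡ w
    by-cases (zero     , inj₁ eq) = inj₂ (zero , eq)
    by-cases (zero     , inj₂ eq) = inj₂ (suc zero , eq)
    by-cases (suc zero , inj₁ eq) = inj₁ eq
    by-cases (suc zero , inj₂ eq) = inj₂ (suc (suc zero) , eq)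

-- The lower point over the root is `(1,1,1)`, where `2su - t = 1 = t`.
varphi₂-root : varphi (suc zero) root ≡ root
varphi₂-root = trans (same-fibre (low root) one (Π-low root) Π-one
  (sym (*-cancelˡ-≡ 1 _ 2 (Fibre.a≡ (fibre root)))) (suc zero)) (trans (Π≡π (φ (suc zero) one)) (𝒯-≡ refl refl))

varphi₂-fixed : ∀ v → varphi (suc zero) v ≡ v → v ≡ root
varphi₂-fixed v e =
  let s≡1 , t≡1 = φ₂-fixes-t (low v) (Π-reflects-t (φ (suc zero) (low v)) (low v) (trans e (sym (Π-low v))))
  in trans (sym (Π-low v)) (trans (Π-cong (low v) one s≡1 t≡1) Π-one)

degree-root : HasDegree 𝒯-graph root 3
degree-root = moving root , moving-injective root , λ w → mk⇔ to from
  where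
  to : ∀ {w} → Edge root w → ∃[ i ] moving root i ≡ w
  to e = [ (λ eq → contradiction (trans (sym varphi₂-root) eq) (proj₁ e)) , id ]′ (edge-cases root e)
  from : ∀ {w} → ∃[ i ] moving root i ≡ w → Edge root w
  from (i , eq) = subst (Edge root) eq (moving-edge root i)

degree-nonroot : ∀ v → v ≢ root → HasDegree 𝒯-graph v 4
degree-nonroot v v≢root = nbr , injective , λ w → mk⇔ to from
  where
  nbr : Fin 4 → 𝒯
  nbr zero    = varphi (suc zero) v
  nbr (suc i) = moving v i
  injective : Injective _≡_ _≡_ nbr
  injective {zero}  {zero}  _ = refl
  injective {zero}  {suc j} e = contradiction e (varphi₂≢moving v j)
  injective {suc i} {zero}  e = contradiction (sym e) (varphi₂≢moving v i)
  injective {suc i} {suc j} e = cong suc (moving-injective v e)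
  to : ∀ {w} → Edge v w → ∃[ i ] nbr i ≡ w
  to e = [ (λ eq → zero , eq) , (λ (i , eq) → suc i , eq) ]′ (edge-cases v e)
  edge : ∀ i → Edge v (nbr i)
  edge zero    = varphi-edge (suc zero) v (v≢root ∘ varphi₂-fixed v ∘ sym)
  edge (suc i) = moving-edge v i
  from : ∀ {w} → ∃[ i ] nbr i ≡ w → Edge v w
  from (i , eq) = subst (Edge v) eq (edge i)

mainTheorem4 : Infinite 𝒯-graph
    × IsTree 𝒯-graph
    × HasDegree 𝒯-graph root 3
    × (∀ v → v ≢ root → HasDegree 𝒯-graph v 4)
    × (Σ[ varphi ∈ (Fin 2 → 𝒯 → 𝒯) ] Σ[ psi ∈ (Fin 2 → 𝒯 → 𝒯) ]
    (∀ i → varphi i IsTheMap VarphiGraph i)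
    × (∀ i → psi i IsTheMap PsiGraph i)
    × (∀ v → Generated varphi psi v))
mainTheorem4 = infinite , (connected , acyclic) , degree-root , degree-nonroot
  , varphi , psi , varphi-map , psi-map , generated
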